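{- Let $k$ be a finite field of odd characteristic, let $A(t)\in k[t]$ be a square-free polynomial of odd degree $d>1$, and suppose that $A'(t)=\gamma$ for some constant $\gamma\in k^*$. Let $E:y^2=f(x)$ be an elliptic curve defined over $k$, with $f(x)\in k[x]$ cubic, and let $E_A$ be the elliptic curve over $k(t)$ defined by $A(t)y^2=f(x)$. Suppose $(F,G)$ is a point of $E_A$ with $F,G\in k[t]$ and $F'\neq 0$. Then the following three conditions are equivalent: (A) $2 \deg F \leq d-1$; (B) $2 \deg G \leq \deg F-1$; (C) $G^2=\beta F'$ for some $\beta\in k^*$. Furthermore, if one of these conditions holds, then $j(E)=1728$.
   Context: $F'$ and $A'$ denote formal derivatives with respect to $t$; $j(E)$ is the $j$-invariant of $E$. -}

module Defs where

open import Level using (Level; _⊔_) renaming (suc to lsuc)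
open import Algebra.Bundles using (CommutativeRing)
open import Data.Nat using (ℕ; zero; suc; _<_)
open import Data.Fin using (Fin)
open import Data.List using (List; []; _∷_; map)
open import Data.Product using (Σ; ∃; _×_; _,_)
open import Relation.Nullary using (¬_)
open import Function.Bundles using (Bijection)
import Relation.Binary.PropositionalEquality as ≡

record Field (c ℓ : Level) : Set (lsuc (c ⊔ ℓ)) where
  field
    commutativeRing : CommutativeRing c ℓ
  open CommutativeRing commutativeRing public
  field
    1≉0     : ¬ (1# ≈ 0#)
    inverse : ∀ x → ¬ (x ≈ 0#) → ∃ λ y → x * y ≈ 1#

IsFinite : ∀ {c ℓ} → Field c ℓ → Set (c ⊔ ℓ)
IsFinite K = ∃ λ n → Bijection (≡.setoid (Fin n)) (Field.setoid K)

-- Polynomials over a field, as coefficient lists (constant term first),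
-- compared coefficientwise (so trailing zeros are irrelevant).
module PolyOver {c ℓ} (K : Field c ℓ) where
  open Field K

  _·_ : ℕ → Carrier → Carrier
  zero  · a = 0#
  suc n · a = a + (n · a)

  nat : ℕ → Carrier
  nat n = n · 1#

  Poly : Set c
  Poly = List Carrier

  coeff : Poly → ℕ → Carrier
  coeff []      n       = 0#
  coeff (a ∷ p) zero    = a
  coeff (a ∷ p) (suc n) = coeff p n

  _≈P_ : Poly → Poly → Set ℓ
  p ≈P q = ∀ n → coeff p n ≈ coeff q n

  constP : Carrier → Poly
  constP a = a ∷ []

  _+P_ : Poly → Poly → Poly
  []      +P q       = q
  (a ∷ p) +P []      = a ∷ p
  (a ∷ p) +P (b ∷ q) = (a + b) ∷ (p +P q)

  _*P_ : Poly → Poly → Poly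
  []      *P q = []
  (a ∷ p) *P q = map (a *_) q +P (0# ∷ (p *P q))

  derivAux : ℕ → Poly → Poly
  derivAux n []      = []
  derivAux n (b ∷ q) = (n · b) ∷ derivAux (suc n) q

  deriv : Poly → Poly
  deriv []      = []
  deriv (a ∷ p) = derivAux 1 p

  HasDegree : Poly → ℕ → Set ℓ
  HasDegree p d = ¬ (coeff p d ≈ 0#) × (∀ m → d < m → coeff p m ≈ 0#)

  IsConstant : Poly → Set ℓ
  IsConstant p = ∀ m → 0 < m → coeff p m ≈ 0#

  SquareFree : Poly → Set (c ⊔ ℓ)
  SquareFree p = ∀ P Q → p ≈P ((P *P P) *P Q) → IsConstant P

  cubicAt : Carrier → Carrier → Carrier → Carrier → Poly → Poly
  cubicAt a0 a1 a2 a3 F =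
    constP a0 +P ((constP a1 *P F) +P ((constP a2 *P (F *P F))
      +P (constP a3 *P ((F *P F) *P F))))

  -- Weierstrass invariants of y^2 = a3 x^3 + a2 x^2 + a1 x + a0.
  -- With X = a3 x, Y = a3 y this becomes Y^2 = X^3 + a2 X^2 + a3 a1 X + a3^2 a0,
  -- i.e. Weierstrass coefficients (0, a2, 0, a3 a1, a3^2 a0).
  module Cubic (a0 a1 a2 a3 : Carrier) where
    W2 W4 W6 : Carrier
    W2 = a2
    W4 = a3 * a1
    W6 = (a3 * a3) * a0
    b2 b4 b6 b8 : Carrier
    b2 = nat 4 * W2
    b4 = nat 2 * W4
    b6 = nat 4 * W6
    b8 = (nat 4 * (W2 * W6)) - (W4 * W4)
    c4 : Carrier
    c4 = (b2 * b2) - (nat 24 * b4)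
    Δ : Carrier
    Δ = ((((- ((b2 * b2) * b8)) - (nat 8 * ((b4 * b4) * b4)))
          - (nat 27 * (b6 * b6))) + (nat 9 * ((b2 * b4) * b6)))
    -- j(E) = c4^3 / Δ ;  "j(E) = 1728" written as c4^3 = 1728 Δ (Δ ≠ 0)
    j≈1728 : Set ℓ
    j≈1728 = ((c4 * c4) * c4) ≈ (nat 1728 * Δ)
    IsElliptic : Set ℓ
    IsElliptic = ¬ (a3 ≈ 0#) × ¬ (Δ ≈ 0#)

-- Put X = a₃F and Y = a₃G, so that A Y² = f(X) with f a monic cubic of discriminant D, and let
-- m = deg F, g = deg G. Comparing degrees gives d + 2g = 3m, so (A) and (B) both say 2g < m, and
-- (C) implies 2g = deg F′ < m.
--
-- (B) ⇒ (C). Differentiating, Y (γY + 2AY′) = f′(X) X′, and Bézout for f and f′ gives D X′ = Y H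
-- for a polynomial H, hence D (γY + 2AY′) = f′(X) H. Modulo A, where f(X) vanishes, DγY / H is a
-- value of f′ at a root of f, so A divides the homogenised characteristic polynomial
-- z³ - s z² H + D H³ of these values at z = DγY. Its degree is at most 3 max (g, deg H) < d, so it
-- vanishes. Thus z / H is algebraic over k, hence a constant, and Y² is a multiple of Y H = D X′.
--
-- (C) ⇒ j = 1728. If Y² = βX′ then 2βAY′ = (f′(X) - βγ) Y. Let L be the linear pseudo-remainder of
-- f modulo f′ - βγ. Then f(X) divides L(X) Y³, of degree at most m + 3g < 3m, so L = 0, and this
-- puts the inflection point of f at one of its roots.

module Submission where

open import Defs
open import Data.Nat using (ℕ; _∸_; _<_; _≤_) renaming (_*_ to _*ℕ_; _+_ to _+ℕ_)
open import Data.Product using (∃; _×_)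
open import Data.Sum using (_⊎_)
open import Relation.Nullary using (¬_)
open import Data.List using ([])
open import Relation.Binary.PropositionalEquality using (_≡_)

open import Algebra.Bundles using (AbelianGroup; CommutativeRing)
import Algebra.Properties.AbelianGroup as AbelianGroupProperties
import Algebra.Properties.CommutativeMonoid.Mult as CommutativeMultiple
import Algebra.Properties.CommutativeSemigroup as CommutativeSemigroupProperties
import Algebra.Properties.Ring as RingProperties
import Algebra.Properties.Semiring.Mult as Multiple
import Algebra.Solver.Ring as RingSolver
open import Algebra.Solver.Ring.AlmostCommutativeRing using (fromCommutativeRing; _-Raw-AlmostCommutative⟶_)
open import Algebra.Structures using (IsAbelianGroup)
import Data.Fin as Fin
open import Data.Integer as ℤ using (ℤ; +_; -[1+_])
import Data.Integer.Properties as ℤ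
open import Data.List using (_∷_; map)
open import Data.Maybe using (Maybe; just; nothing)
open import Data.Nat using (zero; suc; z≤n; s≤s) renaming (_⊔_ to _⊔ℕ_)
import Data.Nat.Properties as ℕ
open import Data.Nat.Solver using (module +-*-Solver)
open import Data.Product using (_,_; proj₁; proj₂)
open import Data.Sum using (inj₁; inj₂; [_,_]′)
open import Function.Bundles using (Bijection)
open import Level using (_⊔_)
open import Relation.Binary.Bundles using (Setoid)
open import Relation.Binary.Definitions using (Decidable; tri<; tri≈; tri>)
import Relation.Binary.PropositionalEquality as ≡
import Relation.Binary.Reasoning.Setoid as SetoidReasoning
open import Relation.Nullary using (yes; no; contradiction)

-- Ring solver with integer coefficients over a commutative ring.

module IntegerSolver {c ℓ} (R : CommutativeRing c ℓ) where
  open CommutativeRing R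
  open Multiple semiring using (×-homo-+; ×1-homo-*) renaming (_×_ to _⋆_)
  open RingProperties ring using (-‿distribˡ-*; -‿distribʳ-*; -0#≈0#; -‿involutive)
  open AbelianGroupProperties +-abelianGroup using (⁻¹-∙-comm)
  open SetoidReasoning setoid

  fromℤ : ℤ → Carrier
  fromℤ (+ n)      = n ⋆ 1#
  fromℤ (-[1+ n ]) = - (suc n ⋆ 1#)

  fromℤ-neg : ∀ i → fromℤ (ℤ.- i) ≈ - fromℤ i
  fromℤ-neg (+ zero)   = sym -0#≈0#
  fromℤ-neg (+ suc n)  = refl
  fromℤ-neg (-[1+ n ]) = sym (-‿involutive _)

  fromℤ-⊖ : ∀ m n → fromℤ (m ℤ.⊖ n) ≈ (m ⋆ 1#) - (n ⋆ 1#)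
  fromℤ-⊖ m       zero    = sym (trans (+-congˡ -0#≈0#) (+-identityʳ _))
  fromℤ-⊖ zero    (suc n) = sym (+-identityˡ _)
  fromℤ-⊖ (suc m) (suc n) = begin
    fromℤ (suc m ℤ.⊖ suc n)                  ≡⟨ ≡.cong fromℤ (ℤ.[1+m]⊖[1+n]≡m⊖n m n) ⟩
    fromℤ (m ℤ.⊖ n)                          ≈⟨ fromℤ-⊖ m n ⟩
    (m ⋆ 1#) - (n ⋆ 1#)                      ≈⟨ +-congʳ (+-identityʳ _) ⟨
    ((m ⋆ 1#) + 0#) - (n ⋆ 1#)               ≈⟨ +-congʳ (+-congˡ (-‿inverseʳ 1#)) ⟨
    -- Inserting `1# - 1#` gives each of the two multiples the extra summand it lacks.
    ((m ⋆ 1#) + (1# - 1#)) - (n ⋆ 1#)        ≈⟨ +-congʳ (+-assoc _ _ _) ⟨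
    (((m ⋆ 1#) + 1#) - 1#) - (n ⋆ 1#)        ≈⟨ +-assoc _ _ _ ⟩
    ((m ⋆ 1#) + 1#) + (- 1# - (n ⋆ 1#))      ≈⟨ +-cong (+-comm _ _) (⁻¹-∙-comm _ _) ⟩
    (suc m ⋆ 1#) - (suc n ⋆ 1#)              ∎

  fromℤ-+ : ∀ i j → fromℤ (i ℤ.+ j) ≈ fromℤ i + fromℤ j
  fromℤ-+ (+ m)      (+ n)      = ×-homo-+ 1# m n
  fromℤ-+ (+ m)      (-[1+ n ]) = fromℤ-⊖ m (suc n)
  fromℤ-+ (-[1+ m ]) (+ n)      = trans (fromℤ-⊖ n (suc m)) (+-comm _ _)
  fromℤ-+ (-[1+ m ]) (-[1+ n ]) = begin
    - (suc (suc (m +ℕ n)) ⋆ 1#)          ≡⟨ ≡.cong (λ k → - (suc k ⋆ 1#)) (ℕ.+-suc m n) ⟨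
    - ((suc m +ℕ suc n) ⋆ 1#)            ≈⟨ -‿cong (×-homo-+ 1# (suc m) (suc n)) ⟩
    - ((suc m ⋆ 1#) + (suc n ⋆ 1#))      ≈⟨ ⁻¹-∙-comm _ _ ⟨
    - (suc m ⋆ 1#) - (suc n ⋆ 1#)        ∎

  fromℤ-*-+ : ∀ m j → fromℤ (+ m ℤ.* j) ≈ (m ⋆ 1#) * fromℤ j
  fromℤ-*-+ m (+ n)      = begin
    fromℤ (+ m ℤ.* + n)    ≡⟨ ≡.cong fromℤ (ℤ.pos-* m n) ⟨
    (m *ℕ n) ⋆ 1#          ≈⟨ ×1-homo-* m n ⟩
    (m ⋆ 1#) * (n ⋆ 1#)    ∎
  fromℤ-*-+ m (-[1+ n ]) = begin
    fromℤ (+ m ℤ.* ℤ.- (+ suc n))      ≡⟨ ≡.cong fromℤ (ℤ.neg-distribʳ-* (+ m) (+ suc n)) ⟨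
    fromℤ (ℤ.- (+ m ℤ.* + suc n))      ≈⟨ fromℤ-neg (+ m ℤ.* + suc n) ⟩
    - fromℤ (+ m ℤ.* + suc n)          ≈⟨ -‿cong (fromℤ-*-+ m (+ suc n)) ⟩
    - ((m ⋆ 1#) * (suc n ⋆ 1#))        ≈⟨ -‿distribʳ-* _ _ ⟩
    (m ⋆ 1#) * - (suc n ⋆ 1#)          ∎

  fromℤ-* : ∀ i j → fromℤ (i ℤ.* j) ≈ fromℤ i * fromℤ j
  fromℤ-* (+ m)      j = fromℤ-*-+ m j
  fromℤ-* (-[1+ m ]) j = begin
    fromℤ (ℤ.- (+ suc m) ℤ.* j)     ≡⟨ ≡.cong fromℤ (ℤ.neg-distribˡ-* (+ suc m) j) ⟨
    fromℤ (ℤ.- (+ suc m ℤ.* j))     ≈⟨ fromℤ-neg (+ suc m ℤ.* j) ⟩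
    - fromℤ (+ suc m ℤ.* j)         ≈⟨ -‿cong (fromℤ-*-+ (suc m) j) ⟩
    - ((suc m ⋆ 1#) * fromℤ j)      ≈⟨ -‿distribˡ-* _ _ ⟩
    - (suc m ⋆ 1#) * fromℤ j        ∎

  ℤ⟶R : CommutativeRing.rawRing ℤ.+-*-commutativeRing -Raw-AlmostCommutative⟶ fromCommutativeRing R
  ℤ⟶R = record
    { ⟦_⟧    = fromℤ
    ; +-homo = fromℤ-+
    ; *-homo = fromℤ-*
    ; -‿homo = fromℤ-neg
    ; 0-homo = refl
    ; 1-homo = +-identityʳ 1#
    }

  -- Only equality is ever confirmed: in positive characteristic distinct integers may have the same
  -- image, so their being distinct refutes nothing.
  fromℤ-≟ : ∀ i j → Maybe (fromℤ i ≈ fromℤ j)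
  fromℤ-≟ i j with i ℤ.≟ j
  ... | yes ≡.refl = just refl
  ... | no _       = nothing

  open RingSolver _ _ ℤ⟶R fromℤ-≟ public using (solve; _:=_; con; _:+_; _:*_; _:-_; :-_; Polynomial)

-- Formulas attached to a monic cubic.

record Operations {a} (A : Set a) : Set a where
  infixl 6 _+_ _-_
  infixl 7 _*_
  infix 8 #_
  field
    _+_ _-_ _*_ : A → A → A
    #_          : ℕ → A

-- Bare operations without laws are enough to write the formulas, so one text serves ring elements,
-- solver expressions and constants of K[t].
module CubicTerms {a} {A : Set a} (O : Operations A) where
  open Operations O

  cubic : (p q r x : A) → A
  cubic p q r x = ((x + p) * x + q) * x + r

  cubic′ : (p q x : A) → A
  cubic′ p q x = (# 3 * x + # 2 * p) * x + q

  -- The homogenisation of z³ - s z² + D, with `h` as second variable.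
  form : (s D z h : A) → A
  form s D z h = z * z * z - s * (z * z * h) + D * (h * h * h)

  opaque
    disc : (p q r : A) → A
    disc p q r = p * p * (q * q) - # 4 * (q * q * q) - # 4 * (p * p * p * r) - # 27 * (r * r) + # 18 * (p * q * r)

    -- Bézout coefficients of cubic and cubic′, from the Euclidean algorithm over ℤ after removing
    -- a common factor 9.
    U V : (p q r x : A) → A
    U p q r x = (# 18 * q - # 6 * (p * p)) * x + (# 15 * (p * q) - # 4 * (p * p * p) - # 27 * r)
    V p q r x = ((# 6 * q - # 2 * (p * p)) * x + (# 7 * (p * q) - # 2 * (p * p * p) - # 9 * r)) * x
                + (# 4 * (q * q) - p * p * q - # 3 * (p * r))

    -- With s = trace, the values of cubic′ at the three roots of cubic are the roots of
    -- z³ - s z² + disc; the coefficient of z vanishes because Σ 1 / cubic′(root) = 0.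
    trace : (p q : A) → A
    trace p q = p * p - # 3 * q

    -- rem₁ x + rem₀ is the pseudo-remainder of cubic modulo cubic′ - c.
    rem₁ rem₀ : (p q r c : A) → A
    rem₁ p q r c = # 6 * q + # 3 * c - # 2 * (p * p)
    rem₀ p q r c = # 9 * r - p * (q - c)

    -- 27 times the value of cubic at its inflection point - p / 3; c₆ is - 32 times this.
    inflection : (p q r : A) → A
    inflection p q r = # 27 * r - # 9 * (p * q) + # 2 * (p * p * p)

-- Identities for a monic cubic over a commutative ring.

module MonicCubic {c ℓ} (R : CommutativeRing c ℓ) where
  open CommutativeRing R
  open Multiple semiring using () renaming (_×_ to _⋆_)
  open IntegerSolver R
  open SetoidReasoning setoid
  private module A = RingProperties ring

  operations : Operations Carrier
  operations = record { _+_ = _+_ ; _-_ = _-_ ; _*_ = _*_ ; #_ = λ n → n ⋆ 1# }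

  symbolic : ∀ {n} → Operations (Polynomial n)
  symbolic = record { _+_ = _:+_ ; _-_ = _:-_ ; _*_ = _:*_ ; #_ = λ n → con (+ n) }

  open Operations operations public using (#_)
  open CubicTerms operations public
  private module S {n} = CubicTerms (symbolic {n})

  -- For work modulo `a`: the first variable of the form may be replaced by anything congruent to
  -- it.
  form-shift : ∀ s D y z a h → form s D (y - a * z) h
    ≈ form s D y h + a * (s * h * (# 2 * (y * z) - a * (z * z))
                          - z * (# 3 * (y * y) - # 3 * (a * (y * z)) + a * a * (z * z)))
  form-shift = solve 6 (λ s D y z a h → S.form s D (y :- a :* z) h
    := S.form s D y h :+ a :* (s :* h :* (con (+ 2) :* (y :* z) :- a :* (z :* z))
                            :- z :* (con (+ 3) :* (y :* y) :- con (+ 3) :* (a :* (y :* z)) :+ a :* a :* (z :* z)))) refl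

  -- Taylor expansion of the form about the line z = b h, nested in powers of `y` so that a factor
  -- `y` can be split off repeatedly.
  form-line : ∀ s D y b h → form s D (y + b * h) h
    ≈ (b * b * b - s * (b * b) + D) * (h * h * h)
      + y * ((# 3 * (b * b) - # 2 * (s * b)) * (h * h) + y * ((# 3 * b - s) * h + y))
  form-line = solve 5 (λ s D y b h → S.form s D (y :+ b :* h) h
    := (b :* b :* b :- s :* (b :* b) :+ D) :* (h :* h :* h)
       :+ y :* ((con (+ 3) :* (b :* b) :- con (+ 2) :* (s :* b)) :* (h :* h) :+ y :* ((con (+ 3) :* b :- s) :* h :+ y))) refl

  opaque
    unfolding CubicTerms.disc

    bezout : ∀ p q r x → U p q r x * cubic p q r x - V p q r x * cubic′ p q x ≈ disc p q r
    bezout = solve 4 (λ p q r x →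
      S.U p q r x :* S.cubic p q r x :- S.V p q r x :* S.cubic′ p q x := S.disc p q r) refl

    -- Up to h³, substituting `bezout` for the discriminant leaves `U` times the cubic plus g′ (g′²
    -- - s g′ - V), and g′² - s g′ - V is the cubic times 9 x + 3 p.
    form-cubic′ : ∀ p q r x h → let g′ = cubic′ p q x in
      form (trace p q) (disc p q r) (g′ * h) h
        ≈ cubic p q r x * ((U p q r x + g′ * (# 9 * x + # 3 * p)) * (h * h * h))
    form-cubic′ = solve 5 (λ p q r x h → let g′ = S.cubic′ p q x in
      S.form (S.trace p q) (S.disc p q r) (g′ :* h) h
        := S.cubic p q r x :* ((S.U p q r x :+ g′ :* (con (+ 9) :* x :+ con (+ 3) :* p)) :* (h :* h :* h))) refl

    pseudoRemainder : ∀ p q r c x →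
      # 9 * cubic p q r x - (# 3 * x + p) * (cubic′ p q x - c) ≈ rem₁ p q r c * x + rem₀ p q r c
    pseudoRemainder = solve 5 (λ p q r c x →
      con (+ 9) :* S.cubic p q r x :- (con (+ 3) :* x :+ p) :* (S.cubic′ p q x :- c)
        := S.rem₁ p q r c :* x :+ S.rem₀ p q r c) refl

    -- `c` cancels on the right, so a vanishing pseudo-remainder makes the inflection value vanish
    -- whatever `c` is.
    inflection-rem : ∀ p q r c → inflection p q r ≈ # 3 * rem₀ p q r c - p * rem₁ p q r c
    inflection-rem = solve 4 (λ p q r c → S.inflection p q r := con (+ 3) :* S.rem₀ p q r c :- p :* S.rem₁ p q r c) refl

    Δ-disc : ∀ p q r → let b₂ = # 4 * p ; b₄ = # 2 * q ; b₆ = # 4 * r ; b₈ = # 4 * (p * r) - q * q in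
      - (b₂ * b₂ * b₈) - # 8 * (b₄ * b₄ * b₄) - # 27 * (b₆ * b₆) + # 9 * (b₂ * b₄ * b₆) ≈ # 16 * disc p q r
    Δ-disc = solve 3 (λ p q r → let
        b₂ = con (+ 4) :* p ; b₄ = con (+ 2) :* q ; b₆ = con (+ 4) :* r ; b₈ = con (+ 4) :* (p :* r) :- q :* q
      in :- (b₂ :* b₂ :* b₈) :- con (+ 8) :* (b₄ :* b₄ :* b₄) :- con (+ 27) :* (b₆ :* b₆) :+ con (+ 9) :* (b₂ :* b₄ :* b₆)
        := con (+ 16) :* S.disc p q r) refl

    -- This is c₄³ - c₆² = 1728 Δ with c₆ = -32 `inflection p q r`, whence the factor 1024.
    c₄³-Δ : ∀ p q r → let
        b₂ = # 4 * p ; b₄ = # 2 * q ; b₆ = # 4 * r ; b₈ = # 4 * (p * r) - q * q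
        c₄ = b₂ * b₂ - # 24 * b₄
        Δ = - (b₂ * b₂ * b₈) - # 8 * (b₄ * b₄ * b₄) - # 27 * (b₆ * b₆) + # 9 * (b₂ * b₄ * b₆)
      in c₄ * c₄ * c₄ ≈ # 1728 * Δ + # 1024 * (inflection p q r * inflection p q r)
    c₄³-Δ = solve 3 (λ p q r → let
        b₂ = con (+ 4) :* p ; b₄ = con (+ 2) :* q ; b₆ = con (+ 4) :* r ; b₈ = con (+ 4) :* (p :* r) :- q :* q
        c₄ = b₂ :* b₂ :- con (+ 24) :* b₄
        Δ = :- (b₂ :* b₂ :* b₈) :- con (+ 8) :* (b₄ :* b₄ :* b₄) :- con (+ 27) :* (b₆ :* b₆) :+ con (+ 9) :* (b₂ :* b₄ :* b₆)
      in c₄ :* c₄ :* c₄ := con (+ 1728) :* Δ :+ con (+ 1024) :* (S.inflection p q r :* S.inflection p q r)) refl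

  -- Multiplying the equation by a₃² makes the cubic monic in a₃ f.
  rescale : ∀ a c₀ c₁ c₂ a₃ f g →
    a * (g * g) ≈ c₀ + (c₁ * f + (c₂ * (f * f) + a₃ * (f * f * f))) →
    a * (a₃ * g * (a₃ * g)) ≈ cubic c₂ (a₃ * c₁) (a₃ * a₃ * c₀) (a₃ * f)
  rescale a c₀ c₁ c₂ a₃ f g e = begin
    a * (a₃ * g * (a₃ * g))    ≈⟨ solve 3 (λ a g b → a :* (b :* g :* (b :* g)) := b :* b :* (a :* (g :* g))) refl a g a₃ ⟩
    a₃ * a₃ * (a * (g * g))    ≈⟨ *-congˡ e ⟩
    a₃ * a₃ * (c₀ + (c₁ * f + (c₂ * (f * f) + a₃ * (f * f * f))))
      ≈⟨ solve 5 (λ c₀ c₁ c₂ a₃ f → a₃ :* a₃ :* (c₀ :+ (c₁ :* f :+ (c₂ :* (f :* f) :+ a₃ :* (f :* f :* f))))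
           := S.cubic c₂ (a₃ :* c₁) (a₃ :* a₃ :* c₀) (a₃ :* f)) refl c₀ c₁ c₂ a₃ f ⟩
    cubic c₂ (a₃ * c₁) (a₃ * a₃ * c₀) (a₃ * f) ∎

  -- Eliminating `h` between the two proportions ends the step to (C); the factor `D` is cancelled
  -- later, in K[t].
  square-from-proportion : ∀ D γ γ⁻¹ b x′ y h → D * x′ ≈ y * h → D * γ * y ≈ b * h → γ * γ⁻¹ ≈ 1# →
    D * (y * y) ≈ D * (γ⁻¹ * b * x′)
  square-from-proportion D γ γ⁻¹ b x′ y h Dx′≈yh Dγy≈bh γγ⁻¹≈1 = begin
    D * (y * y)               ≈⟨ *-identityˡ _ ⟨
    1# * (D * (y * y))        ≈⟨ *-congʳ γγ⁻¹≈1 ⟨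
    γ * γ⁻¹ * (D * (y * y))   ≈⟨ solve 4 (λ γ i D y → γ :* i :* (D :* (y :* y)) := i :* y :* (D :* γ :* y)) refl γ γ⁻¹ D y ⟩
    γ⁻¹ * y * (D * γ * y)     ≈⟨ *-congˡ Dγy≈bh ⟩
    γ⁻¹ * y * (b * h)         ≈⟨ solve 4 (λ i b y h → i :* y :* (b :* h) := i :* b :* (y :* h)) refl γ⁻¹ b y h ⟩
    γ⁻¹ * b * (y * h)         ≈⟨ *-congˡ Dx′≈yh ⟨
    γ⁻¹ * b * (D * x′)        ≈⟨ solve 3 (λ β D x′ → β :* (D :* x′) := D :* (β :* x′)) refl (γ⁻¹ * b) D x′ ⟩
    D * (γ⁻¹ * b * x′)        ∎

  form-cong : ∀ s D h {z z′} → z ≈ z′ → form s D z h ≈ form s D z′ h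
  form-cong s D h z≈ = +-congʳ (+-cong (*-cong (*-cong z≈ z≈) z≈) (-‿cong (*-congˡ (*-congʳ (*-cong z≈ z≈)))))

  -- A solution (x, y) of a y² = cubic x, with x′, y′ the derivatives of x and y, γ that of a, and
  -- the differentiated equation with y split off.
  module Point (p q r a γ x y x′ y′ : Carrier)
    (onCurve : a * (y * y) ≈ cubic p q r x)
    (tangent : y * (γ * y + a * (y′ + y′)) ≈ cubic′ p q x * x′) where

    private
      D = disc p q r
      u = U p q r x
      v = V p q r x
      f = cubic p q r x
      f′ = cubic′ p q x
      w = γ * y + a * (y′ + y′)

    -- The H of (B) ⇒ (C). In D x′ = u f x′ - v f′ x′ both terms contain `y`, since f = a y² and f′
    -- x′ = y w; this is what remains after splitting it off.
    cofactor : Carrier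
    cofactor = u * a * y * x′ - v * w

    disc-x′ : D * x′ ≈ y * cofactor
    disc-x′ = begin
      D * x′                               ≈⟨ *-congʳ (bezout p q r x) ⟨
      (u * f - v * f′) * x′
        ≈⟨ solve 5 (λ u f v f′ x′ →
             (u :* f :- v :* f′) :* x′ := u :* x′ :* f :- v :* (f′ :* x′)) refl u f v f′ x′ ⟩
      u * x′ * f - v * (f′ * x′)           ≈⟨ +-cong (*-congˡ onCurve) (-‿cong (*-congˡ tangent)) ⟨
      u * x′ * (a * (y * y)) - v * (y * w)
        ≈⟨ solve 6 (λ u x′ a y v w →
             u :* x′ :* (a :* (y :* y)) :- v :* (y :* w) := y :* (u :* a :* y :* x′ :- v :* w)) refl u x′ a y v w ⟩
      y * cofactor                         ∎

    -- The factor `y` stays on both sides because the ring is arbitrary here; it is cancelled over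
    -- K[t].
    disc-tangent : y * (D * w) ≈ y * (f′ * cofactor)
    disc-tangent = begin
      y * (D * w)           ≈⟨ solve 3 (λ y D w → y :* (D :* w) := D :* (y :* w)) refl y D w ⟩
      D * (y * w)           ≈⟨ *-congˡ tangent ⟩
      D * (f′ * x′)         ≈⟨ solve 3 (λ D f′ x′ → D :* (f′ :* x′) := f′ :* (D :* x′)) refl D f′ x′ ⟩
      f′ * (D * x′)         ≈⟨ *-congˡ disc-x′ ⟩
      f′ * (y * cofactor)   ≈⟨ solve 3 (λ f′ y h → f′ :* (y :* h) := y :* (f′ :* h)) refl f′ y cofactor ⟩
      y * (f′ * cofactor)   ∎

    -- Modulo `a` the value `D * γ * y` is congruent to f′ h, where the form is a multiple of f by
    -- `form-cubic′`; and f = a y² is a multiple of `a`.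
    a∣form : D * w ≈ f′ * cofactor → ∃ λ t → form (trace p q) D (D * γ * y) cofactor ≈ a * t
    a∣form e = _ , (begin
      form s D (D * γ * y) h      ≈⟨ form-cong s D h Dγy ⟩
      form s D (f′ * h - a * z) h ≈⟨ form-shift s D (f′ * h) z a h ⟩
      form s D (f′ * h) h + a * _ ≈⟨ +-congʳ (form-cubic′ p q r x h) ⟩
      f * _ + a * _               ≈⟨ +-congʳ (*-congʳ onCurve) ⟨
      a * (y * y) * _ + a * _     ≈⟨ +-congʳ (*-assoc a (y * y) _) ⟩
      a * _ + a * _               ≈⟨ distribˡ a _ _ ⟨
      a * _                       ∎)
      where
      s = trace p q
      h = cofactor
      z = D * (y′ + y′)
      Dγy : D * γ * y ≈ f′ * h - a * z
      Dγy = trans (solve 5 (λ D γ y a y′ →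
        D :* γ :* y := D :* (γ :* y :+ a :* (y′ :+ y′)) :- a :* (D :* (y′ :+ y′))) refl D γ y a y′)
        (+-congʳ e)

    module _ (β : Carrier) (y²≈βx′ : y * y ≈ β * x′) where

      β-tangent : y * (β * w) ≈ y * (f′ * y)
      β-tangent = begin
        y * (β * w)      ≈⟨ solve 3 (λ y β w → y :* (β :* w) := β :* (y :* w)) refl y β w ⟩
        β * (y * w)      ≈⟨ *-congˡ tangent ⟩
        β * (f′ * x′)    ≈⟨ solve 3 (λ β f′ x′ → β :* (f′ :* x′) := f′ :* (β :* x′)) refl β f′ x′ ⟩
        f′ * (β * x′)    ≈⟨ *-congˡ y²≈βx′ ⟨
        f′ * (y * y)     ≈⟨ solve 2 (λ f′ y → f′ :* (y :* y) := y :* (f′ :* y)) refl f′ y ⟩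
        y * (f′ * y)     ∎

      -- From β w = f′ y follows (f′ - βγ) y = 2 β a y′, so (f′ - βγ) y³ is a multiple of a y² = f.
      -- The pseudo-remainder is a combination of f and f′ - βγ.
      cubic∣rem : β * w ≈ f′ * y →
        ∃ λ t → (rem₁ p q r (β * γ) * x + rem₀ p q r (β * γ)) * (y * y * y) ≈ f * t
      cubic∣rem e = _ , (begin
        (rem₁ p q r k * x + rem₀ p q r k) * (y * y * y)
          ≈⟨ *-congʳ (pseudoRemainder p q r k x) ⟨
        (# 9 * f - l * (f′ - k)) * (y * y * y)
          ≈⟨ solve 5 (λ f l f′ k y → (con (+ 9) :* f :- l :* (f′ :- k)) :* (y :* y :* y)
               := f :* (con (+ 9) :* (y :* y :* y)) :- l :* ((f′ :* y :- k :* y) :* (y :* y))) refl f l f′ k y ⟩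
        f * (# 9 * (y * y * y)) - l * ((f′ * y - k * y) * (y * y))
          ≈⟨ +-congˡ (-‿cong (*-congˡ (*-congʳ (+-congʳ e)))) ⟨
        f * (# 9 * (y * y * y)) - l * ((β * w - k * y) * (y * y))
          ≈⟨ +-congˡ (-‿cong (solve 6 (λ l β γ y a y′ → l :* ((β :* (γ :* y :+ a :* (y′ :+ y′)) :- β :* γ :* y) :* (y :* y))
               := a :* (y :* y) :* (l :* β :* (y′ :+ y′))) refl l β γ y a y′)) ⟩
        f * (# 9 * (y * y * y)) - a * (y * y) * (l * β * (y′ + y′))
          ≈⟨ +-congˡ (-‿cong (*-congʳ onCurve)) ⟩
        f * (# 9 * (y * y * y)) - f * (l * β * (y′ + y′))
          ≈⟨ A.x[y-z]≈xy-xz f _ _ ⟨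
        f * (# 9 * (y * y * y) - l * β * (y′ + y′)) ∎)
        where
        k = β * γ
        l = # 3 * x + p

-- The commutative ring K[t] on coefficient lists.

module PolynomialRing {c ℓ} (K : Field c ℓ) where
  open Field K
  open PolyOver K
  open RingProperties ring using (-0#≈0#)
  open Multiple semiring using (×-comm-*) renaming (_×_ to _⋆_; ×-congʳ to ⋆-congʳ; ×-congˡ to ⋆-congˡ)
  open CommutativeMultiple +-commutativeMonoid using (×-distrib-+)

  -- A record, so that p and q can be inferred from a proof of p ≋ q.
  infix 4 _≋_
  record _≋_ (p q : Poly) : Set ℓ where
    constructor coeffs
    field coeff-≈ : p ≈P q
  open _≋_ public

  ≋-refl : ∀ {p} → p ≋ p
  ≋-refl = coeffs λ _ → refl

  ≋-sym : ∀ {p q} → p ≋ q → q ≋ p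
  ≋-sym (coeffs e) = coeffs λ n → sym (e n)

  ≋-trans : ∀ {p q r} → p ≋ q → q ≋ r → p ≋ r
  ≋-trans (coeffs e) (coeffs f) = coeffs λ n → trans (e n) (f n)

  ≋-setoid : Setoid c ℓ
  ≋-setoid = record
    { Carrier = Poly ; _≈_ = _≋_
    ; isEquivalence = record { refl = ≋-refl ; sym = ≋-sym ; trans = ≋-trans } }

  open SetoidReasoning ≋-setoid

  infixl 6 _⊕_
  infixl 7 _⊛_
  infixl 8 _⊙_
  infix 8 ⊖_
  infixr 9 X∙_

  -- Opaque, so that implicit arguments can be inferred from sums and products.
  opaque
    _⊕_ _⊛_ : Poly → Poly → Poly
    _⊕_ = _+P_
    _⊛_ = _*P_

    _⊙_ : Carrier → Poly → Poly
    a ⊙ p = map (a *_) p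

    ⊖_ : Poly → Poly
    ⊖_ = map (-_)

    coeff-⊕ : ∀ p q n → coeff (p ⊕ q) n ≈ coeff p n + coeff q n
    coeff-⊕ []      q       n       = sym (+-identityˡ _)
    coeff-⊕ (a ∷ p) []      n       = sym (+-identityʳ _)
    coeff-⊕ (a ∷ p) (b ∷ q) zero    = refl
    coeff-⊕ (a ∷ p) (b ∷ q) (suc n) = coeff-⊕ p q n

    coeff-⊙ : ∀ a p n → coeff (a ⊙ p) n ≈ a * coeff p n
    coeff-⊙ a []      n       = sym (zeroʳ a)
    coeff-⊙ a (b ∷ p) zero    = refl
    coeff-⊙ a (b ∷ p) (suc n) = coeff-⊙ a p n

    coeff-⊖ : ∀ p n → coeff (⊖ p) n ≈ - coeff p n
    coeff-⊖ []      n       = sym -0#≈0#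
    coeff-⊖ (b ∷ p) zero    = refl
    coeff-⊖ (b ∷ p) (suc n) = coeff-⊖ p n

    -- Together with `∷-⊛`, this recursion is all that the ring laws below use about the opaque
    -- product.
    []-⊛ : ∀ q → [] ⊛ q ≋ []
    []-⊛ q = ≋-refl

    ∷-⊛ : ∀ a p q → (a ∷ p) ⊛ q ≋ a ⊙ q ⊕ (0# ∷ p ⊛ q)
    ∷-⊛ a p q = ≋-refl

  X∙_ : Poly → Poly
  X∙ p = 0# ∷ p

  ∷-cong : ∀ {a b p q} → a ≈ b → p ≋ q → (a ∷ p) ≋ (b ∷ q)
  ∷-cong a≈b (coeffs e) = coeffs λ { zero → a≈b ; (suc n) → e n }

  X∙-cong : ∀ {p q} → p ≋ q → X∙ p ≋ X∙ q
  X∙-cong = ∷-cong refl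

  X∙-zero : X∙ [] ≋ []
  X∙-zero = coeffs λ { zero → refl ; (suc n) → refl }

  ⊕-cong : ∀ {p q r s} → p ≋ q → r ≋ s → p ⊕ r ≋ q ⊕ s
  ⊕-cong {p} {q} {r} {s} (coeffs e) (coeffs f) = coeffs λ n →
    trans (coeff-⊕ p r n) (trans (+-cong (e n) (f n)) (sym (coeff-⊕ q s n)))

  ⊕-congˡ : ∀ {p r s} → r ≋ s → p ⊕ r ≋ p ⊕ s
  ⊕-congˡ = ⊕-cong ≋-refl

  ⊕-assoc : ∀ p q r → (p ⊕ q) ⊕ r ≋ p ⊕ (q ⊕ r)
  ⊕-assoc p q r = coeffs λ n → trans (trans (coeff-⊕ (p ⊕ q) r n) (+-congʳ (coeff-⊕ p q n)))
    (trans (+-assoc _ _ _) (sym (trans (coeff-⊕ p (q ⊕ r) n) (+-congˡ (coeff-⊕ q r n)))))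

  ⊕-comm : ∀ p q → p ⊕ q ≋ q ⊕ p
  ⊕-comm p q = coeffs λ n → trans (coeff-⊕ p q n) (trans (+-comm _ _) (sym (coeff-⊕ q p n)))

  ⊕-identityʳ : ∀ p → p ⊕ [] ≋ p
  ⊕-identityʳ p = coeffs λ n → trans (coeff-⊕ p [] n) (+-identityʳ _)

  ⊖-cong : ∀ {p q} → p ≋ q → ⊖ p ≋ ⊖ q
  ⊖-cong {p} {q} (coeffs e) = coeffs λ n → trans (coeff-⊖ p n) (trans (-‿cong (e n)) (sym (coeff-⊖ q n)))

  ⊖-inverseʳ : ∀ p → p ⊕ ⊖ p ≋ []
  ⊖-inverseʳ p = coeffs λ n → trans (coeff-⊕ p (⊖ p) n) (trans (+-congˡ (coeff-⊖ p n)) (-‿inverseʳ _))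

  ⊕-identityˡ : ∀ p → [] ⊕ p ≋ p
  ⊕-identityˡ p = ≋-trans (⊕-comm [] p) (⊕-identityʳ p)

  ⊕-isAbelianGroup : IsAbelianGroup _≋_ _⊕_ [] ⊖_
  ⊕-isAbelianGroup = record
    { isGroup = record
      { isMonoid = record
        { isSemigroup = record
          { isMagma = record { isEquivalence = Setoid.isEquivalence ≋-setoid ; ∙-cong = ⊕-cong }
          ; assoc = ⊕-assoc }
        ; identity = ⊕-identityˡ , ⊕-identityʳ }
      ; inverse = (λ p → ≋-trans (⊕-comm (⊖ p) p) (⊖-inverseʳ p)) , ⊖-inverseʳ
      ; ⁻¹-cong = ⊖-cong }
    ; comm = ⊕-comm }

  ⊕-abelianGroup : AbelianGroup c ℓ
  ⊕-abelianGroup = record { isAbelianGroup = ⊕-isAbelianGroup }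

  open CommutativeSemigroupProperties (AbelianGroup.commutativeSemigroup ⊕-abelianGroup)
    using () renaming (interchange to ⊕-interchange; x∙yz≈y∙xz to ⊕-swap)

  X∙-⊕ : ∀ p q → X∙ (p ⊕ q) ≋ X∙ p ⊕ X∙ q
  X∙-⊕ p q = coeffs λ
    { zero → sym (trans (coeff-⊕ (X∙ p) (X∙ q) 0) (+-identityˡ 0#))
    ; (suc n) → trans (coeff-⊕ p q n) (sym (coeff-⊕ (X∙ p) (X∙ q) (suc n))) }

  ⊙-cong : ∀ {a b p q} → a ≈ b → p ≋ q → a ⊙ p ≋ b ⊙ q
  ⊙-cong {a} {b} {p} {q} a≈b (coeffs e) = coeffs λ n →
    trans (coeff-⊙ a p n) (trans (*-cong a≈b (e n)) (sym (coeff-⊙ b q n)))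

  ⊙-distribˡ : ∀ a p q → a ⊙ (p ⊕ q) ≋ a ⊙ p ⊕ a ⊙ q
  ⊙-distribˡ a p q = coeffs λ n → trans (trans (coeff-⊙ a (p ⊕ q) n) (*-congˡ (coeff-⊕ p q n)))
    (trans (distribˡ _ _ _) (sym (trans (coeff-⊕ (a ⊙ p) (a ⊙ q) n) (+-cong (coeff-⊙ a p n) (coeff-⊙ a q n)))))

  ⊙-assoc : ∀ a b p → (a * b) ⊙ p ≋ a ⊙ (b ⊙ p)
  ⊙-assoc a b p = coeffs λ n → trans (coeff-⊙ (a * b) p n)
    (trans (*-assoc _ _ _) (sym (trans (coeff-⊙ a (b ⊙ p) n) (*-congˡ (coeff-⊙ b p n)))))

  ⊙-zeroʳ : ∀ a → a ⊙ [] ≋ []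
  ⊙-zeroʳ a = coeffs λ n → trans (coeff-⊙ a [] n) (zeroʳ a)

  ⊙-zeroˡ : ∀ p → 0# ⊙ p ≋ []
  ⊙-zeroˡ p = coeffs λ n → trans (coeff-⊙ 0# p n) (zeroˡ _)

  ⊙-identityˡ : ∀ p → 1# ⊙ p ≋ p
  ⊙-identityˡ p = coeffs λ n → trans (coeff-⊙ 1# p n) (*-identityˡ _)

  ⊙-∷ : ∀ a b p → a ⊙ (b ∷ p) ≋ (a * b) ∷ a ⊙ p
  ⊙-∷ a b p = coeffs λ
    { zero → coeff-⊙ a (b ∷ p) 0
    ; (suc n) → trans (coeff-⊙ a (b ∷ p) (suc n)) (sym (coeff-⊙ a p n)) }

  ⊙-X∙ : ∀ a p → a ⊙ X∙ p ≋ X∙ (a ⊙ p)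
  ⊙-X∙ a p = ≋-trans (⊙-∷ a 0# p) (∷-cong (zeroʳ a) ≋-refl)

  ∷-⊕-X∙ : ∀ a p q → (a ∷ p) ⊕ X∙ q ≋ a ∷ p ⊕ q
  ∷-⊕-X∙ a p q = coeffs λ
    { zero → trans (coeff-⊕ (a ∷ p) (X∙ q) 0) (+-identityʳ a)
    ; (suc n) → trans (coeff-⊕ (a ∷ p) (X∙ q) (suc n)) (sym (coeff-⊕ p q n)) }

  ⊛-congˡ : ∀ p {q r} → q ≋ r → p ⊛ q ≋ p ⊛ r
  ⊛-congˡ []      {q} {r} e = ≋-trans ([]-⊛ q) (≋-sym ([]-⊛ r))
  ⊛-congˡ (a ∷ p) {q} {r} e = begin
    (a ∷ p) ⊛ q           ≈⟨ ∷-⊛ a p q ⟩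
    a ⊙ q ⊕ X∙ (p ⊛ q)    ≈⟨ ⊕-cong (⊙-cong refl e) (X∙-cong (⊛-congˡ p e)) ⟩
    a ⊙ r ⊕ X∙ (p ⊛ r)    ≈⟨ ∷-⊛ a p r ⟨
    (a ∷ p) ⊛ r           ∎

  ⊛-distribˡ : ∀ p q r → p ⊛ (q ⊕ r) ≋ p ⊛ q ⊕ p ⊛ r
  ⊛-distribˡ []      q r = begin
    [] ⊛ (q ⊕ r)      ≈⟨ []-⊛ (q ⊕ r) ⟩
    []                ≈⟨ ⊕-identityˡ [] ⟨
    [] ⊕ []           ≈⟨ ⊕-cong ([]-⊛ q) ([]-⊛ r) ⟨
    [] ⊛ q ⊕ [] ⊛ r   ∎
  ⊛-distribˡ (a ∷ p) q r = begin
    (a ∷ p) ⊛ (q ⊕ r)                            ≈⟨ ∷-⊛ a p (q ⊕ r) ⟩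
    a ⊙ (q ⊕ r) ⊕ X∙ (p ⊛ (q ⊕ r))
      ≈⟨ ⊕-cong (⊙-distribˡ a q r) (≋-trans (X∙-cong (⊛-distribˡ p q r)) (X∙-⊕ (p ⊛ q) (p ⊛ r))) ⟩
    (a ⊙ q ⊕ a ⊙ r) ⊕ (X∙ (p ⊛ q) ⊕ X∙ (p ⊛ r))  ≈⟨ ⊕-interchange _ _ _ _ ⟩
    (a ⊙ q ⊕ X∙ (p ⊛ q)) ⊕ (a ⊙ r ⊕ X∙ (p ⊛ r))  ≈⟨ ⊕-cong (∷-⊛ a p q) (∷-⊛ a p r) ⟨
    (a ∷ p) ⊛ q ⊕ (a ∷ p) ⊛ r                    ∎

  ⊛-zeroʳ : ∀ p → p ⊛ [] ≋ []
  ⊛-zeroʳ []      = []-⊛ []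
  ⊛-zeroʳ (a ∷ p) = begin
    (a ∷ p) ⊛ []          ≈⟨ ∷-⊛ a p [] ⟩
    a ⊙ [] ⊕ X∙ (p ⊛ [])  ≈⟨ ⊕-cong (⊙-zeroʳ a) (≋-trans (X∙-cong (⊛-zeroʳ p)) X∙-zero) ⟩
    [] ⊕ []               ≈⟨ ⊕-identityˡ [] ⟩
    []                    ∎

  -- The recursion of the product mirrored to its second argument, from which commutativity follows
  -- by induction.
  ⊛-∷ : ∀ p b q → p ⊛ (b ∷ q) ≋ b ⊙ p ⊕ X∙ (p ⊛ q)
  ⊛-∷ []      b q = begin
    [] ⊛ (b ∷ q)            ≈⟨ []-⊛ (b ∷ q) ⟩
    []                      ≈⟨ ⊕-identityˡ [] ⟨
    [] ⊕ []                 ≈⟨ ⊕-cong (⊙-zeroʳ b) (≋-trans (X∙-cong ([]-⊛ q)) X∙-zero) ⟨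
    b ⊙ [] ⊕ X∙ ([] ⊛ q)    ∎
  ⊛-∷ (a ∷ p) b q = begin
    (a ∷ p) ⊛ (b ∷ q)                       ≈⟨ ∷-⊛ a p (b ∷ q) ⟩
    a ⊙ (b ∷ q) ⊕ X∙ (p ⊛ (b ∷ q))          ≈⟨ ⊕-cong (⊙-∷ a b q) ≋-refl ⟩
    (a * b ∷ a ⊙ q) ⊕ X∙ (p ⊛ (b ∷ q))      ≈⟨ ∷-⊕-X∙ _ _ _ ⟩
    a * b ∷ a ⊙ q ⊕ p ⊛ (b ∷ q)             ≈⟨ ∷-cong (*-comm a b) (⊕-congˡ (⊛-∷ p b q)) ⟩
    b * a ∷ a ⊙ q ⊕ (b ⊙ p ⊕ X∙ (p ⊛ q))    ≈⟨ ∷-cong refl (⊕-swap _ _ _) ⟩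
    b * a ∷ b ⊙ p ⊕ (a ⊙ q ⊕ X∙ (p ⊛ q))    ≈⟨ ∷-⊕-X∙ _ _ _ ⟨
    (b * a ∷ b ⊙ p) ⊕ X∙ (a ⊙ q ⊕ X∙ (p ⊛ q))
      ≈⟨ ⊕-cong (⊙-∷ b a p) (X∙-cong (∷-⊛ a p q)) ⟨
    b ⊙ (a ∷ p) ⊕ X∙ ((a ∷ p) ⊛ q)          ∎

  ⊛-comm : ∀ p q → p ⊛ q ≋ q ⊛ p
  ⊛-comm []      q = ≋-trans ([]-⊛ q) (≋-sym (⊛-zeroʳ q))
  ⊛-comm (a ∷ p) q = begin
    (a ∷ p) ⊛ q         ≈⟨ ∷-⊛ a p q ⟩
    a ⊙ q ⊕ X∙ (p ⊛ q)  ≈⟨ ⊕-congˡ (X∙-cong (⊛-comm p q)) ⟩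
    a ⊙ q ⊕ X∙ (q ⊛ p)  ≈⟨ ⊛-∷ q a p ⟨
    q ⊛ (a ∷ p)         ∎

  -- Equal polynomials may be lists of different lengths, which makes induction on the first factor
  -- awkward; commutativity moves the change to the second factor.
  ⊛-cong : ∀ {p q r s} → p ≋ q → r ≋ s → p ⊛ r ≋ q ⊛ s
  ⊛-cong {p} {q} {r} {s} e f = begin
    p ⊛ r  ≈⟨ ⊛-congˡ p f ⟩
    p ⊛ s  ≈⟨ ⊛-comm p s ⟩
    s ⊛ p  ≈⟨ ⊛-congˡ s e ⟩
    s ⊛ q  ≈⟨ ⊛-comm s q ⟩
    q ⊛ s  ∎

  ⊛-distribʳ : ∀ p q r → (q ⊕ r) ⊛ p ≋ q ⊛ p ⊕ r ⊛ p
  ⊛-distribʳ p q r = begin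
    (q ⊕ r) ⊛ p    ≈⟨ ⊛-comm (q ⊕ r) p ⟩
    p ⊛ (q ⊕ r)    ≈⟨ ⊛-distribˡ p q r ⟩
    p ⊛ q ⊕ p ⊛ r  ≈⟨ ⊕-cong (⊛-comm p q) (⊛-comm p r) ⟩
    q ⊛ p ⊕ r ⊛ p  ∎

  X∙-⊛ : ∀ p q → X∙ p ⊛ q ≋ X∙ (p ⊛ q)
  X∙-⊛ p q = begin
    X∙ p ⊛ q              ≈⟨ ∷-⊛ 0# p q ⟩
    0# ⊙ q ⊕ X∙ (p ⊛ q)   ≈⟨ ⊕-cong (⊙-zeroˡ q) ≋-refl ⟩
    [] ⊕ X∙ (p ⊛ q)       ≈⟨ ⊕-identityˡ _ ⟩
    X∙ (p ⊛ q)            ∎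

  constP-⊛ : ∀ a p → constP a ⊛ p ≋ a ⊙ p
  constP-⊛ a p = begin
    constP a ⊛ p          ≈⟨ ∷-⊛ a [] p ⟩
    a ⊙ p ⊕ X∙ ([] ⊛ p)   ≈⟨ ⊕-congˡ (≋-trans (X∙-cong ([]-⊛ p)) X∙-zero) ⟩
    a ⊙ p ⊕ []            ≈⟨ ⊕-identityʳ _ ⟩
    a ⊙ p                 ∎

  ⊙-⊛ : ∀ a p q → a ⊙ p ⊛ q ≋ a ⊙ (p ⊛ q)
  ⊙-⊛ a []      q = begin
    a ⊙ [] ⊛ q     ≈⟨ ⊛-cong (⊙-zeroʳ a) ≋-refl ⟩
    [] ⊛ q         ≈⟨ []-⊛ q ⟩
    []             ≈⟨ ⊙-zeroʳ a ⟨
    a ⊙ []         ≈⟨ ⊙-cong refl ([]-⊛ q) ⟨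
    a ⊙ ([] ⊛ q)   ∎
  ⊙-⊛ a (b ∷ p) q = begin
    a ⊙ (b ∷ p) ⊛ q                ≈⟨ ⊛-cong (⊙-∷ a b p) ≋-refl ⟩
    (a * b ∷ a ⊙ p) ⊛ q            ≈⟨ ∷-⊛ (a * b) (a ⊙ p) q ⟩
    (a * b) ⊙ q ⊕ X∙ (a ⊙ p ⊛ q)   ≈⟨ ⊕-cong (⊙-assoc a b q) (X∙-cong (⊙-⊛ a p q)) ⟩
    a ⊙ (b ⊙ q) ⊕ X∙ (a ⊙ (p ⊛ q)) ≈⟨ ⊕-congˡ (⊙-X∙ a (p ⊛ q)) ⟨
    a ⊙ (b ⊙ q) ⊕ a ⊙ X∙ (p ⊛ q)   ≈⟨ ⊙-distribˡ a (b ⊙ q) (X∙ (p ⊛ q)) ⟨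
    a ⊙ (b ⊙ q ⊕ X∙ (p ⊛ q))       ≈⟨ ⊙-cong refl (∷-⊛ b p q) ⟨
    a ⊙ ((b ∷ p) ⊛ q)              ∎

  ⊛-assoc : ∀ p q r → p ⊛ q ⊛ r ≋ p ⊛ (q ⊛ r)
  ⊛-assoc []      q r = begin
    [] ⊛ q ⊛ r     ≈⟨ ⊛-cong ([]-⊛ q) ≋-refl ⟩
    [] ⊛ r         ≈⟨ []-⊛ r ⟩
    []             ≈⟨ []-⊛ (q ⊛ r) ⟨
    [] ⊛ (q ⊛ r)   ∎
  ⊛-assoc (a ∷ p) q r = begin
    (a ∷ p) ⊛ q ⊛ r                  ≈⟨ ⊛-cong (∷-⊛ a p q) ≋-refl ⟩
    (a ⊙ q ⊕ X∙ (p ⊛ q)) ⊛ r         ≈⟨ ⊛-distribʳ r (a ⊙ q) (X∙ (p ⊛ q)) ⟩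
    a ⊙ q ⊛ r ⊕ X∙ (p ⊛ q) ⊛ r       ≈⟨ ⊕-cong (⊙-⊛ a q r) (X∙-⊛ (p ⊛ q) r) ⟩
    a ⊙ (q ⊛ r) ⊕ X∙ (p ⊛ q ⊛ r)     ≈⟨ ⊕-congˡ (X∙-cong (⊛-assoc p q r)) ⟩
    a ⊙ (q ⊛ r) ⊕ X∙ (p ⊛ (q ⊛ r))   ≈⟨ ∷-⊛ a p (q ⊛ r) ⟨
    (a ∷ p) ⊛ (q ⊛ r)                ∎

  ⊛-identityˡ : ∀ p → constP 1# ⊛ p ≋ p
  ⊛-identityˡ p = ≋-trans (constP-⊛ 1# p) (⊙-identityˡ p)

  polynomialRing : CommutativeRing c ℓ
  polynomialRing = record
    { isCommutativeRing = record
      { isRing = record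
        { +-isAbelianGroup = ⊕-isAbelianGroup
        ; *-cong = ⊛-cong
        ; *-assoc = ⊛-assoc
        ; *-identity = ⊛-identityˡ , λ p → ≋-trans (⊛-comm p _) (⊛-identityˡ p)
        ; distrib = ⊛-distribˡ , ⊛-distribʳ
        }
      ; *-comm = ⊛-comm
      }
    }

  constP-cong : ∀ {a b} → a ≈ b → constP a ≋ constP b
  constP-cong e = ∷-cong e ≋-refl

  constP-* : ∀ a b → constP (a * b) ≋ constP a ⊛ constP b
  constP-* a b = ≋-sym (≋-trans (constP-⊛ a (constP b)) (coeffs λ
    { zero → coeff-⊙ a (constP b) 0
    ; (suc n) → trans (coeff-⊙ a (constP b) (suc n)) (zeroʳ a) }))

  constP-+ : ∀ a b → constP (a + b) ≋ constP a ⊕ constP b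
  constP-+ a b = coeffs λ
    { zero → sym (coeff-⊕ (constP a) (constP b) 0)
    ; (suc n) → sym (trans (coeff-⊕ (constP a) (constP b) (suc n)) (+-identityˡ 0#)) }

  constP-neg : ∀ a → constP (- a) ≋ ⊖ constP a
  constP-neg a = coeffs λ
    { zero → sym (coeff-⊖ (constP a) 0)
    ; (suc n) → sym (trans (coeff-⊖ (constP a) (suc n)) -0#≈0#) }

  constP-0 : constP 0# ≋ []
  constP-0 = X∙-zero

  -- The formal derivative.

  ·≡⋆ : ∀ n a → n · a ≡ n ⋆ a
  ·≡⋆ zero    a = ≡.refl
  ·≡⋆ (suc n) a = ≡.cong (λ b → a + b) (·≡⋆ n a)

  ⋆-zero : ∀ n → n ⋆ 0# ≈ 0#
  ⋆-zero zero    = refl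
  ⋆-zero (suc n) = trans (+-identityˡ _) (⋆-zero n)

  -- The accumulator `k` is the exponent that the head of the list had before differentiation, hence
  -- the shift.
  coeff-derivAux : ∀ p k n → coeff (derivAux k p) n ≈ (n +ℕ k) ⋆ coeff p n
  coeff-derivAux []      k n       = sym (⋆-zero (n +ℕ k))
  coeff-derivAux (a ∷ p) k zero    = reflexive (·≡⋆ k a)
  coeff-derivAux (a ∷ p) k (suc n) = trans (coeff-derivAux p (suc k) n) (⋆-congˡ (ℕ.+-suc n k))

  coeff-deriv : ∀ p n → coeff (deriv p) n ≈ suc n ⋆ coeff p (suc n)
  coeff-deriv []      n = sym (⋆-zero (suc n))
  coeff-deriv (a ∷ p) n = trans (coeff-derivAux p 1 n) (⋆-congˡ (ℕ.+-comm n 1))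

  deriv-cong : ∀ {p q} → p ≋ q → deriv p ≋ deriv q
  deriv-cong {p} {q} (coeffs e) = coeffs λ n →
    trans (coeff-deriv p n) (trans (⋆-congʳ (suc n) (e (suc n))) (sym (coeff-deriv q n)))

  deriv-⊕ : ∀ p q → deriv (p ⊕ q) ≋ deriv p ⊕ deriv q
  deriv-⊕ p q = coeffs λ n → trans (trans (coeff-deriv (p ⊕ q) n) (⋆-congʳ (suc n) (coeff-⊕ p q (suc n))))
    (trans (×-distrib-+ _ _ (suc n))
      (sym (trans (coeff-⊕ (deriv p) (deriv q) n) (+-cong (coeff-deriv p n) (coeff-deriv q n)))))

  deriv-⊙ : ∀ a p → deriv (a ⊙ p) ≋ a ⊙ deriv p
  deriv-⊙ a p = coeffs λ n → trans (trans (coeff-deriv (a ⊙ p) n) (⋆-congʳ (suc n) (coeff-⊙ a p (suc n))))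
    (trans (sym (×-comm-* (suc n) a (coeff p (suc n))))
      (sym (trans (coeff-⊙ a (deriv p) n) (*-congˡ (coeff-deriv p n)))))

  -- The Leibniz rule for a + t p, on which the induction for `deriv-⊛` rests.
  deriv-∷ : ∀ a p → deriv (a ∷ p) ≋ p ⊕ X∙ (deriv p)
  deriv-∷ a p = coeffs λ
    { zero → trans (coeff-deriv (a ∷ p) 0) (sym (coeff-⊕ p (X∙ (deriv p)) 0))
    ; (suc n) → trans (coeff-deriv (a ∷ p) (suc n))
        (sym (trans (coeff-⊕ p (X∙ (deriv p)) (suc n)) (+-congˡ (coeff-deriv p n)))) }

  deriv-⊛ : ∀ p q → deriv (p ⊛ q) ≋ deriv p ⊛ q ⊕ p ⊛ deriv q
  deriv-⊛ []      q = begin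
    deriv ([] ⊛ q)              ≈⟨ deriv-cong ([]-⊛ q) ⟩
    []                          ≈⟨ ⊕-identityˡ [] ⟨
    [] ⊕ []                     ≈⟨ ⊕-cong ([]-⊛ q) ([]-⊛ (deriv q)) ⟨
    [] ⊛ q ⊕ [] ⊛ deriv q       ∎
  deriv-⊛ (a ∷ p) q = begin
    deriv ((a ∷ p) ⊛ q)
      ≈⟨ ≋-trans (deriv-cong (∷-⊛ a p q)) (deriv-⊕ _ _) ⟩
    deriv (a ⊙ q) ⊕ deriv (X∙ (p ⊛ q))
      ≈⟨ ⊕-cong (deriv-⊙ a q) (deriv-∷ 0# (p ⊛ q)) ⟩
    a ⊙ q′ ⊕ (p ⊛ q ⊕ X∙ (deriv (p ⊛ q)))
      ≈⟨ ⊕-congˡ (⊕-congˡ (≋-trans (X∙-cong (deriv-⊛ p q)) (X∙-⊕ _ _))) ⟩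
    a ⊙ q′ ⊕ (p ⊛ q ⊕ (X∙ (p′ ⊛ q) ⊕ X∙ (p ⊛ q′)))
      ≈⟨ ⊕-congˡ (⊕-assoc _ _ _) ⟨
    a ⊙ q′ ⊕ ((p ⊛ q ⊕ X∙ (p′ ⊛ q)) ⊕ X∙ (p ⊛ q′))
      ≈⟨ ⊕-swap _ _ _ ⟩
    (p ⊛ q ⊕ X∙ (p′ ⊛ q)) ⊕ (a ⊙ q′ ⊕ X∙ (p ⊛ q′))
      ≈⟨ ⊕-cong (⊕-congˡ (X∙-⊛ p′ q)) (∷-⊛ a p q′) ⟨
    (p ⊛ q ⊕ X∙ p′ ⊛ q) ⊕ (a ∷ p) ⊛ q′
      ≈⟨ ⊕-cong (⊛-distribʳ q p (X∙ p′)) ≋-refl ⟨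
    (p ⊕ X∙ p′) ⊛ q ⊕ (a ∷ p) ⊛ q′
      ≈⟨ ⊕-cong (⊛-cong (deriv-∷ a p) ≋-refl) ≋-refl ⟨
    deriv (a ∷ p) ⊛ q ⊕ (a ∷ p) ⊛ q′ ∎
    where
    p′ = deriv p
    q′ = deriv q

-- Degrees of polynomials.

module Degrees {c ℓ} (K : Field c ℓ) (_≟_ : Decidable (Field._≈_ K)) where
  open Field K
  open PolyOver K
  open PolynomialRing K
  open Multiple semiring using () renaming (×-congʳ to ⋆-congʳ)
  open RingProperties ring using (-0#≈0#)
  private module P = RingProperties (CommutativeRing.ring polynomialRing)

  -- The zero polynomial satisfies every such bound, so bounds combine without case distinctions;
  -- `Degree` excludes it.
  record DegreeAtMost (n : ℕ) (p : Poly) : Set ℓ where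
    constructor atMost
    field vanish : ∀ m → n < m → coeff p m ≈ 0#
  open DegreeAtMost public

  record Degree (n : ℕ) (p : Poly) : Set ℓ where
    constructor degree
    field
      leading : ¬ (coeff p n ≈ 0#)
      bound   : DegreeAtMost n p
  open Degree public

  zero-product : ∀ {a b} → ¬ (a ≈ 0#) → a * b ≈ 0# → b ≈ 0#
  zero-product {a} {b} a≉0 ab≈0 with inverse a a≉0
  ... | a⁻¹ , aa⁻¹≈1 = begin
    b                  ≈⟨ *-identityˡ b ⟨
    1# * b             ≈⟨ *-congʳ aa⁻¹≈1 ⟨
    a * a⁻¹ * b        ≈⟨ *-congʳ (*-comm a a⁻¹) ⟩
    a⁻¹ * a * b        ≈⟨ *-assoc a⁻¹ a b ⟩
    a⁻¹ * (a * b)      ≈⟨ *-congˡ ab≈0 ⟩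
    a⁻¹ * 0#           ≈⟨ zeroʳ a⁻¹ ⟩
    0#                 ∎
    where open SetoidReasoning setoid

  atMost-resp : ∀ {n p q} → p ≋ q → DegreeAtMost n p → DegreeAtMost n q
  atMost-resp (coeffs e) (atMost v) = atMost λ m n<m → trans (sym (e m)) (v m n<m)

  atMost-mono : ∀ {n k p} → n ≤ k → DegreeAtMost n p → DegreeAtMost k p
  atMost-mono n≤k (atMost v) = atMost λ m k<m → v m (ℕ.≤-<-trans n≤k k<m)

  atMost-zero : ∀ {n} → DegreeAtMost n []
  atMost-zero = atMost λ _ _ → refl

  atMost-constP : ∀ {a} → DegreeAtMost 0 (constP a)
  atMost-constP = atMost λ { (suc m) _ → refl }

  atMost-⊕ : ∀ {n p q} → DegreeAtMost n p → DegreeAtMost n q → DegreeAtMost n (p ⊕ q)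
  atMost-⊕ {n} {p} {q} (atMost v) (atMost w) = atMost λ m n<m →
    trans (coeff-⊕ p q m) (trans (+-cong (v m n<m) (w m n<m)) (+-identityˡ 0#))

  atMost-⊖ : ∀ {n p} → DegreeAtMost n p → DegreeAtMost n (⊖ p)
  atMost-⊖ {n} {p} (atMost v) = atMost λ m n<m → trans (coeff-⊖ p m) (trans (-‿cong (v m n<m)) -0#≈0#)

  tail-zero : ∀ {a p} → DegreeAtMost 0 (a ∷ p) → p ≋ []
  tail-zero (atMost v) = coeffs λ n → v (suc n) (s≤s z≤n)

  tail-atMost : ∀ {n a p} → DegreeAtMost (suc n) (a ∷ p) → DegreeAtMost n p
  tail-atMost (atMost v) = atMost λ m n<m → v (suc m) (s≤s n<m)

  coeff-∷-⊛ : ∀ a p q n → coeff ((a ∷ p) ⊛ q) n ≈ a * coeff q n + coeff (X∙ (p ⊛ q)) n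
  coeff-∷-⊛ a p q n = trans (coeff-≈ (∷-⊛ a p q) n)
    (trans (coeff-⊕ (a ⊙ q) (X∙ (p ⊛ q)) n) (+-congʳ (coeff-⊙ a q n)))

  -- Induction on `i` as `p` is consumed: for positive `i` the head of `p` meets a coefficient of
  -- `q` beyond `j`, and at zero the tail of `p` vanishes.
  coeff-⊛-top : ∀ {i j} p {q} → DegreeAtMost i p → DegreeAtMost j q →
                coeff (p ⊛ q) (i +ℕ j) ≈ coeff p i * coeff q j
  atMost-⊛ : ∀ {i j} p {q} → DegreeAtMost i p → DegreeAtMost j q → DegreeAtMost (i +ℕ j) (p ⊛ q)

  coeff-⊛-top {i} {j} [] {q} _ _ = trans (coeff-≈ ([]-⊛ q) (i +ℕ j)) (sym (zeroˡ _))
  coeff-⊛-top {zero} {j} (a ∷ p) {q} dp dq = trans (coeff-∷-⊛ a p q j)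
    (trans (+-congˡ (coeff-≈ p⊛q≋0 j)) (+-identityʳ _))
    where
    p⊛q≋0 : X∙ (p ⊛ q) ≋ []
    p⊛q≋0 = ≋-trans (X∙-cong (≋-trans (⊛-cong (tail-zero dp) ≋-refl) ([]-⊛ q))) X∙-zero
  coeff-⊛-top {suc i} {j} (a ∷ p) {q} dp dq = trans (coeff-∷-⊛ a p q (suc (i +ℕ j)))
    (trans (+-cong (trans (*-congˡ (vanish dq _ (s≤s (ℕ.m≤n+m j i)))) (zeroʳ a)) (coeff-⊛-top p (tail-atMost dp) dq))
      (+-identityˡ _))

  atMost-⊛ [] {q} _ _ = atMost-resp (≋-sym ([]-⊛ q)) atMost-zero
  atMost-⊛ {zero} {j} (a ∷ p) {q} dp dq = atMost λ m j<m → trans (coeff-∷-⊛ a p q m)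
    (trans (+-cong (trans (*-congˡ (vanish dq m j<m)) (zeroʳ a)) (coeff-≈ p⊛q≋0 m)) (+-identityˡ 0#))
    where
    p⊛q≋0 : X∙ (p ⊛ q) ≋ []
    p⊛q≋0 = ≋-trans (X∙-cong (≋-trans (⊛-cong (tail-zero dp) ≋-refl) ([]-⊛ q))) X∙-zero
  atMost-⊛ {suc i} {j} (a ∷ p) {q} dp dq = atMost λ { (suc m) (s≤s i+j<m) → trans (coeff-∷-⊛ a p q (suc m))
    (trans (+-cong (trans (*-congˡ (vanish dq _ (s≤s (ℕ.≤-trans (ℕ.m≤n+m j i) (ℕ.<⇒≤ i+j<m))))) (zeroʳ a))
      (vanish (atMost-⊛ p (tail-atMost dp) dq) m i+j<m)) (+-identityˡ 0#)) }

  -- For n = 0 the truncated bound 0 still holds, the derivative being zero.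
  atMost-deriv : ∀ {n p} → DegreeAtMost n p → DegreeAtMost (n ∸ 1) (deriv p)
  atMost-deriv {n} {p} (atMost v) = atMost λ m n-1<m → trans (coeff-deriv p m)
    (trans (⋆-congʳ (suc m) (v (suc m) (s≤s (ℕ.≤-trans (ℕ.m≤n+m∸n n 1) n-1<m)))) (⋆-zero (suc m)))

  deriv-constant : ∀ {p} → DegreeAtMost 0 p → deriv p ≋ []
  deriv-constant {p} (atMost v) = coeffs λ n →
    trans (coeff-deriv p n) (trans (⋆-congʳ (suc n) (v (suc n) (s≤s z≤n))) (⋆-zero (suc n)))

  degree-resp : ∀ {n p q} → p ≋ q → Degree n p → Degree n q
  degree-resp e (degree l b) = degree (λ z → l (trans (coeff-≈ e _) z)) (atMost-resp e b)

  degree-⊛ : ∀ {i j p q} → Degree i p → Degree j q → Degree (i +ℕ j) (p ⊛ q)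
  degree-⊛ {p = p} (degree l b) (degree l′ b′) =
    degree (λ z → l′ (zero-product l (trans (sym (coeff-⊛-top p b b′)) z))) (atMost-⊛ p b b′)

  degree-constP : ∀ {a} → ¬ (a ≈ 0#) → Degree 0 (constP a)
  degree-constP a≉0 = degree a≉0 atMost-constP

  degree-⊕ : ∀ {n k p q} → k < n → Degree n p → DegreeAtMost k q → Degree n (p ⊕ q)
  degree-⊕ {n} {k} {p} {q} k<n (degree l b) (atMost v) = degree
    (λ z → l (trans (sym (trans (coeff-⊕ p q n) (trans (+-congˡ (v n k<n)) (+-identityʳ _)))) z))
    (atMost-⊕ b (atMost-mono (ℕ.<⇒≤ k<n) (atMost v)))

  degree-≤ : ∀ {n k p} → Degree n p → DegreeAtMost k p → n ≤ k
  degree-≤ {n} {k} (degree l _) (atMost v) with n ℕ.≤? k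
  ... | yes n≤k = n≤k
  ... | no n≰k  = contradiction (v n (ℕ.≰⇒> n≰k)) l

  degree-unique : ∀ {n k p} → Degree n p → Degree k p → n ≡ k
  degree-unique d d′ = ℕ.≤-antisym (degree-≤ d (bound d′)) (degree-≤ d′ (bound d))

  degree-nonzero : ∀ {n p} → Degree n p → ¬ (p ≋ [])
  degree-nonzero (degree l _) e = l (coeff-≈ e _)

  -- Trailing entries may vanish, so the last nonzero one is searched for; this is where decidable
  -- equality in K enters.
  degree? : ∀ p → (p ≋ []) ⊎ ∃ λ n → Degree n p
  degree? [] = inj₁ ≋-refl
  degree? (a ∷ p) with degree? p
  ... | inj₂ (n , degree l (atMost v)) = inj₂ (suc n , degree l (atMost λ { (suc m) (s≤s n<m) → v m n<m }))
  ... | inj₁ p≋0 with a ≟ 0#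
  ...   | yes a≈0 = inj₁ (≋-trans (∷-cong a≈0 p≋0) X∙-zero)
  ...   | no a≉0  = inj₂ (0 , degree a≉0 (atMost λ { (suc m) _ → coeff-≈ p≋0 m }))

  nonzero-degree : ∀ {p} → ¬ (p ≋ []) → ∃ λ n → Degree n p
  nonzero-degree {p} p≉0 with degree? p
  ... | inj₁ p≋0 = contradiction p≋0 p≉0
  ... | inj₂ d   = d

  ⊛-zero-cancel : ∀ {p q} → ¬ (p ≋ []) → p ⊛ q ≋ [] → q ≋ []
  ⊛-zero-cancel {p} {q} p≉0 e with degree? q
  ... | inj₁ q≋0 = q≋0
  ... | inj₂ (_ , dq) = contradiction e (degree-nonzero (degree-⊛ (proj₂ (nonzero-degree p≉0)) dq))

  ⊛-cancelˡ : ∀ p {q r} → ¬ (p ≋ []) → p ⊛ q ≋ p ⊛ r → q ≋ r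
  ⊛-cancelˡ p {q} {r} p≉0 e = P.x∙y⁻¹≈ε⇒x≈y q r (⊛-zero-cancel p≉0 (begin
    p ⊛ (q ⊕ ⊖ r)          ≈⟨ ⊛-distribˡ p q (⊖ r) ⟩
    p ⊛ q ⊕ p ⊛ ⊖ r        ≈⟨ ⊕-cong e (≋-sym (P.-‿distribʳ-* p r)) ⟩
    p ⊛ r ⊕ ⊖ (p ⊛ r)      ≈⟨ ⊖-inverseʳ (p ⊛ r) ⟩
    []                     ∎))
    where open SetoidReasoning ≋-setoid

  multiple-zero : ∀ {n k p q r} → Degree n p → DegreeAtMost k q → k < n → q ≋ p ⊛ r → q ≋ []
  multiple-zero {p = p} {r = r} dp dq k<n e with degree? r
  ... | inj₁ r≋0      = ≋-trans e (≋-trans (⊛-congˡ p r≋0) (⊛-zeroʳ p))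
  ... | inj₂ (_ , dr) = contradiction
    (ℕ.≤-trans (ℕ.m≤m+n _ _) (degree-≤ (degree-⊛ dp dr) (atMost-resp e dq))) (ℕ.<⇒≱ k<n)

  -- If `u` were a nonzero constant, `u ⊛ p` would have degree `n`, and `q` is too small to cancel
  -- its leading term.
  constant-zero : ∀ {n k u p q} → DegreeAtMost 0 u → Degree n p → DegreeAtMost k q → k < n →
                  u ⊛ p ⊕ q ≋ [] → u ≋ []
  constant-zero {u = u} du dp dq k<n e with degree? u
  ... | inj₁ u≋0       = u≋0
  ... | inj₂ (i , du′) with degree-≤ du′ du
  ...   | z≤n = contradiction e (degree-nonzero (degree-⊕ k<n (degree-⊛ du′ dp) dq))

-- Transfer of the cubic formulas from K to constant polynomials.

module Constants {c ℓ} (K : Field c ℓ) where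
  open Field K
  open PolyOver K
  open PolynomialRing K
  open Multiple (CommutativeRing.semiring polynomialRing) using () renaming (_×_ to _⋆_)
  private
    module M = MonicCubic commutativeRing
    module MP = MonicCubic polynomialRing

  # : ℕ → Poly
  # n = MP.# n

  constP-# : ∀ n → # n ≋ constP (M.# n)
  constP-# zero    = ≋-sym constP-0
  constP-# (suc n) = ≋-sym (≋-trans (constP-+ 1# _) (⊕-congˡ (≋-sym (constP-# n))))

  -- Evaluating CubicTerms at Constant evaluates it over K and over K[t] simultaneously, together
  -- with a proof that constP maps one value to the other.
  record Constant : Set (c ⊔ ℓ) where
    constructor constant
    field
      {scalar} : Carrier
      {poly}   : Poly
      embeds   : poly ≋ constP scalar
  open Constant public

  constants : Operations Constant
  constants = record
    { _+_ = λ (constant {a} {p} e) (constant {b} {q} f) → constant (≋-trans (⊕-cong e f) (≋-sym (constP-+ a b)))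
    ; _-_ = λ (constant {a} {p} e) (constant {b} {q} f) →
        constant (≋-trans (⊕-cong e (≋-trans (⊖-cong f) (≋-sym (constP-neg b)))) (≋-sym (constP-+ a (- b))))
    ; _*_ = λ (constant {a} {p} e) (constant {b} {q} f) → constant (≋-trans (⊛-cong e f) (≋-sym (constP-* a b)))
    ; #_  = λ n → constant (constP-# n)
    }

  ι : Carrier → Constant
  ι a = constant {a} ≋-refl

  open Operations constants using () renaming (_*_ to _*ᶜ_)
  private module C = CubicTerms constants

  opaque
    unfolding CubicTerms.disc

    constP-disc : ∀ p q r → MP.disc (constP p) (constP q) (constP r) ≋ constP (M.disc p q r)
    constP-disc p q r = embeds (C.disc (ι p) (ι q) (ι r))

    constP-trace : ∀ p q → MP.trace (constP p) (constP q) ≋ constP (M.trace p q)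
    constP-trace p q = embeds (C.trace (ι p) (ι q))

    -- The last argument is a product of constants, the form in which `cubic∣rem` delivers it.
    constP-rem₁ : ∀ p q r β γ →
      MP.rem₁ (constP p) (constP q) (constP r) (constP β ⊛ constP γ) ≋ constP (M.rem₁ p q r (β * γ))
    constP-rem₁ p q r β γ = embeds (C.rem₁ (ι p) (ι q) (ι r) (ι β *ᶜ ι γ))

    constP-rem₀ : ∀ p q r β γ →
      MP.rem₀ (constP p) (constP q) (constP r) (constP β ⊛ constP γ) ≋ constP (M.rem₀ p q r (β * γ))
    constP-rem₀ p q r β γ = embeds (C.rem₀ (ι p) (ι q) (ι r) (ι β *ᶜ ι γ))

-- Homogeneous cubic relations with constant coefficients.

module CubicRelation {c ℓ} (K : Field c ℓ) (_≟_ : Decidable (Field._≈_ K)) where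
  open Field K using (Carrier; 0#; inverse) renaming (_≈_ to _≈ₖ_)
  open PolyOver K
  open PolynomialRing K
  open Degrees K _≟_
  open Constants K
  open CommutativeRing polynomialRing using (_+_; _*_; _-_; -_)
  open MonicCubic polynomialRing using (form; form-line; form-cong)
  open SetoidReasoning ≋-setoid
  private
    module F = Field K
    module P = CommutativeRing polynomialRing
    module PP = RingProperties P.ring
    module C = Operations constants

  atMost-constant : (k : Constant) → DegreeAtMost 0 (poly k)
  atMost-constant k = atMost-resp (≋-sym (embeds k)) atMost-constP

  -- `b` is the quotient of the coefficients of `z` and `h` at `n`.
  quotient-leading : ∀ {n z h} → ¬ (coeff h n ≈ₖ 0#) → ∃ λ b → coeff (z - constP b * h) n ≈ₖ 0#
  quotient-leading {n} {z} {h} h≉0 with inverse (coeff h n) h≉0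
  ... | h⁻¹ , hh⁻¹≈1 = b ,
    F.trans (coeff-⊕ z _ n) (F.trans (F.+-congˡ (F.trans (coeff-⊖ _ n) (F.-‿cong bh))) (F.-‿inverseʳ _))
    where
    b = coeff z n F.* h⁻¹
    bh : coeff (constP b * h) n ≈ₖ coeff z n
    bh = F.trans (coeff-≈ (constP-⊛ b h) n) (F.trans (coeff-⊙ b h n) (F.trans (F.*-assoc _ _ _)
      (F.trans (F.*-congˡ (F.trans (F.*-comm _ _) hh⁻¹≈1)) (F.*-identityʳ _))))

  degree-< : ∀ {i n p} → Degree i p → DegreeAtMost n p → coeff p n ≈ₖ 0# → i < n
  degree-< dp b e = ℕ.≤∧≢⇒< (degree-≤ dp b) λ { ≡.refl → leading dp e }

  -- Top coefficients give k₃ = 0; if y ≠ 0 it can then be divided out, and k₂ and k₁ vanish in turn.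
  homogeneous-zero : ∀ {n y h} (k₁ k₂ k₃ : Constant) → Degree n h → DegreeAtMost n y → coeff y n ≈ₖ 0# →
    poly k₃ * (h * h * h) + y * (poly k₂ * (h * h) + y * (poly k₁ * h + y)) ≋ [] → y ≋ []
  homogeneous-zero {n} {y} {h} k₁ k₂ k₃ dh by y₀ e with degree? y
  ... | inj₁ y≋0      = y≋0
  ... | inj₂ (j , dy) = contradiction y≋0 (degree-nonzero dy)
    where
    j<n : j < n
    j<n = degree-< dy by y₀
    drop : ∀ {u v w} → u ≋ [] → u * v + w ≋ [] → w ≋ []
    drop u≋0 e = ≋-trans (≋-sym (≋-trans (P.+-congʳ (≋-trans (P.*-congʳ u≋0) (P.zeroˡ _))) (P.+-identityˡ _))) e
    b₁ : DegreeAtMost n (poly k₁ * h + y)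
    b₁ = atMost-⊕ (atMost-⊛ (poly k₁) (atMost-constant k₁) (bound dh)) by
    by₁ : DegreeAtMost (j +ℕ n) (y * (poly k₁ * h + y))
    by₁ = atMost-⊛ y (bound dy) b₁
    b₂ : DegreeAtMost (n +ℕ n) (poly k₂ * (h * h) + y * (poly k₁ * h + y))
    b₂ = atMost-⊕ (atMost-⊛ (poly k₂) (atMost-constant k₂) (atMost-⊛ h (bound dh) (bound dh)))
           (atMost-mono (ℕ.+-monoˡ-≤ n (ℕ.<⇒≤ j<n)) by₁)
    k₃≋0 : poly k₃ ≋ []
    k₃≋0 = constant-zero (atMost-constant k₃) (degree-⊛ (degree-⊛ dh dh) dh) (atMost-⊛ y (bound dy) b₂)
      (≡.subst (j +ℕ (n +ℕ n) <_) (≡.sym (ℕ.+-assoc n n n)) (ℕ.+-monoˡ-< (n +ℕ n) j<n)) e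
    e₂ : poly k₂ * (h * h) + y * (poly k₁ * h + y) ≋ []
    e₂ = ⊛-zero-cancel (degree-nonzero dy) (drop k₃≋0 e)
    k₂≋0 : poly k₂ ≋ []
    k₂≋0 = constant-zero (atMost-constant k₂) (degree-⊛ dh dh) by₁ (ℕ.+-monoˡ-< n j<n) e₂
    e₁ : poly k₁ * h + y ≋ []
    e₁ = ⊛-zero-cancel (degree-nonzero dy) (drop k₂≋0 e₂)
    k₁≋0 : poly k₁ ≋ []
    k₁≋0 = constant-zero (atMost-constant k₁) dh (bound dy) j<n e₁
    y≋0 : y ≋ []
    y≋0 = drop k₁≋0 e₁

  -- If the degrees differ, one term outweighs the rest: `D` h³ when deg z < deg h, z³ when deg z >
  -- deg h. If they agree, the multiple b h with the same leading term is subtracted and the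
  -- difference shown to vanish.
  form-proportional : ∀ {i n z h} (s D : Constant) → ¬ (poly D ≋ []) → Degree i z → Degree n h →
    form (poly s) (poly D) z h ≋ [] → ∃ λ b → z ≋ constP b * h
  form-proportional {i} {n} {z} {h} s D D≉0 dz dh e with ℕ.<-cmp i n
  ... | tri< i<n _ _ = contradiction
    (constant-zero (atMost-constant D) (degree-⊛ (degree-⊛ dh dh) dh)
      (atMost-⊕ (atMost-mono (ℕ.+-monoʳ-≤ (i +ℕ i) (ℕ.<⇒≤ i<n)) (atMost-⊛ (z * z) bz² (bound dz))) bsz²h)
      (ℕ.+-monoˡ-< n (ℕ.+-mono-< i<n i<n)) (≋-trans (P.+-comm _ _) e))
    D≉0
    where
    bz² : DegreeAtMost (i +ℕ i) (z * z)
    bz² = atMost-⊛ z (bound dz) (bound dz)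
    bsz²h : DegreeAtMost (i +ℕ i +ℕ n) (- (poly s * (z * z * h)))
    bsz²h = atMost-⊖ (atMost-⊛ (poly s) (atMost-constant s) (atMost-⊛ (z * z) bz² (bound dh)))
  ... | tri> _ _ n<i = contradiction (≋-trans (≋-sym (P.+-assoc _ _ _)) e) (degree-nonzero
    (degree-⊕ (ℕ.+-monoʳ-< (i +ℕ i) n<i) (degree-⊛ (degree-⊛ dz dz) dz)
      (atMost-⊕ bsz²h (atMost-⊛ (poly D) (atMost-constant D)
        (atMost-mono (ℕ.+-monoˡ-≤ n (ℕ.+-mono-≤ (ℕ.<⇒≤ n<i) (ℕ.<⇒≤ n<i)))
          (atMost-⊛ (h * h) (atMost-⊛ h (bound dh) (bound dh)) (bound dh)))))))
    where
    bz² : DegreeAtMost (i +ℕ i) (z * z)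
    bz² = atMost-⊛ z (bound dz) (bound dz)
    bsz²h : DegreeAtMost (i +ℕ i +ℕ n) (- (poly s * (z * z * h)))
    bsz²h = atMost-⊖ (atMost-⊛ (poly s) (atMost-constant s) (atMost-⊛ (z * z) bz² (bound dh)))
  ... | tri≈ _ ≡.refl _ with quotient-leading {z = z} {h} (leading dh)
  ...   | b , y₀ = b , PP.x∙y⁻¹≈ε⇒x≈y z (constP b * h)
    (homogeneous-zero k₁ k₂ k₃ dh
      (atMost-⊕ (bound dz) (atMost-⊖ (atMost-⊛ (constP b) atMost-constP (bound dh)))) y₀
      (≋-trans (≋-sym (form-line (poly s) (poly D) y (constP b) h)) (≋-trans (form-cong (poly s) (poly D) h y+bh) e)))
    where
    y = z - constP b * h
    y+bh : y + constP b * h ≋ z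
    y+bh = ≋-trans (P.+-assoc _ _ _) (≋-trans (P.+-congˡ (P.-‿inverseˡ _)) (P.+-identityʳ z))
    -- The Taylor coefficients from `form-line`.
    k₁ = C.# 3 C.* ι b C.- s
    k₂ = C.# 3 C.* (ι b C.* ι b) C.- C.# 2 C.* (s C.* ι b)
    k₃ = ι b C.* ι b C.* ι b C.- s C.* (ι b C.* ι b) C.+ D

-- The twisted curve a y² = f(x) over K[t] for a monic cubic f.

module Twist {c ℓ} (K : Field c ℓ) (_≟_ : Decidable (Field._≈_ K)) where
  open Field K using (Carrier; 0#; inverse) renaming (_≈_ to _≈ₖ_; _*_ to _*ₖ_)
  open PolyOver K
  open PolynomialRing K
  open Degrees K _≟_
  open Constants K
  open CubicRelation K _≟_
  open CommutativeRing polynomialRing using (_+_; _*_; _-_; -_)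
  open MonicCubic polynomialRing using (cubic; cubic′; disc; trace; form; rem₁; rem₀; square-from-proportion; module Point)
  open IntegerSolver polynomialRing
  open SetoidReasoning ≋-setoid
  private
    module F = Field K
    module FP = RingProperties F.ring
    module P = CommutativeRing polynomialRing
    module M = MonicCubic F.commutativeRing

  deriv-+constP : ∀ p a → deriv (p + constP a) ≋ deriv p
  deriv-+constP p a = ≋-trans (deriv-⊕ p (constP a)) (P.+-identityʳ _)

  deriv-cubic : ∀ p q r x →
    deriv (cubic (constP p) (constP q) (constP r) x) ≋ cubic′ (constP p) (constP q) x * deriv x
  deriv-cubic p q r x = begin
    deriv (cubic P Q (constP r) x)
      ≈⟨ ≋-trans (deriv-+constP _ r) (deriv-⊛ _ x) ⟩
    deriv ((x + P) * x + Q) * x + ((x + P) * x + Q) * x′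
      ≈⟨ P.+-congʳ (P.*-congʳ (≋-trans (deriv-+constP _ q) (deriv-⊛ _ x))) ⟩
    (deriv (x + P) * x + (x + P) * x′) * x + ((x + P) * x + Q) * x′
      ≈⟨ P.+-congʳ (P.*-congʳ (P.+-congʳ (P.*-congʳ (deriv-+constP x p)))) ⟩
    (x′ * x + (x + P) * x′) * x + ((x + P) * x + Q) * x′
      ≈⟨ solve 4 (λ P Q x x′ → (x′ :* x :+ (x :+ P) :* x′) :* x :+ ((x :+ P) :* x :+ Q) :* x′
           := ((con (+ 3) :* x :+ con (+ 2) :* P) :* x :+ Q) :* x′) ≋-refl P Q x x′ ⟩
    cubic′ P Q x * x′ ∎
    where
    P = constP p
    Q = constP q
    x′ = deriv x

  deriv-twist : ∀ a y γ → deriv a ≋ γ → deriv (a * (y * y)) ≋ y * (γ * y + a * (deriv y + deriv y))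
  deriv-twist a y γ e = begin
    deriv (a * (y * y))                        ≈⟨ deriv-⊛ a (y * y) ⟩
    deriv a * (y * y) + a * deriv (y * y)      ≈⟨ P.+-cong (P.*-congʳ e) (P.*-congˡ (deriv-⊛ y y)) ⟩
    γ * (y * y) + a * (y′ * y + y * y′)
      ≈⟨ solve 4 (λ γ a y y′ → γ :* (y :* y) :+ a :* (y′ :* y :+ y :* y′)
           := y :* (γ :* y :+ a :* (y′ :+ y′))) ≋-refl γ a y y′ ⟩
    y * (γ * y + a * (y′ + y′))                ∎
    where y′ = deriv y

  -- In Horner form each multiplication by `x` adds `m`, and the constants added lie below the
  -- leading term because `m` is positive.
  degree-cubic : ∀ p q r {m x} → Degree m x → 0 < m →
    Degree (m +ℕ m +ℕ m) (cubic (constP p) (constP q) (constP r) x)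
  degree-cubic p q r {m} dx 0<m =
    degree-⊕ (ℕ.<-≤-trans 0<m (ℕ.m≤n+m m (m +ℕ m))) (degree-⊛
      (degree-⊕ (ℕ.<-≤-trans 0<m (ℕ.m≤n+m m m)) (degree-⊛
        (degree-⊕ 0<m dx atMost-constP) dx) atMost-constP) dx) atMost-constP

  module _
    (p q r γ : Carrier) (γ≉0 : ¬ (γ ≈ₖ 0#))
    {d m g : ℕ} {a x y : Poly}
    (da : Degree d a) (dx : Degree m x) (dy : Degree g y) (0<m : 0 < m)
    (a′ : deriv a ≋ constP γ)
    (onCurve : a * (y * y) ≋ cubic (constP p) (constP q) (constP r) x)
    where

    private
      x′ y′ f : Poly
      x′ = deriv x
      y′ = deriv y
      f = cubic (constP p) (constP q) (constP r) x

    tangent : y * (constP γ * y + a * (y′ + y′)) ≋ cubic′ (constP p) (constP q) x * x′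
    tangent = begin
      y * (constP γ * y + a * (y′ + y′))  ≈⟨ deriv-twist a y (constP γ) a′ ⟨
      deriv (a * (y * y))                 ≈⟨ deriv-cong onCurve ⟩
      deriv f                             ≈⟨ deriv-cubic p q r x ⟩
      cubic′ (constP p) (constP q) x * x′                 ∎

    open Point (constP p) (constP q) (constP r) a (constP γ) x y x′ y′ onCurve tangent

    degree-twist : d +ℕ (g +ℕ g) ≡ m +ℕ m +ℕ m
    degree-twist = degree-unique (degree-resp onCurve (degree-⊛ da (degree-⊛ dy dy))) (degree-cubic p q r dx 0<m)

    private
      y≉0 : ¬ (y ≋ [])
      y≉0 = degree-nonzero dy

    -- The bound 2g < m keeps the form below degree `d`, so `a∣form` makes it zero and
    -- `form-proportional` applies.
    square∝derivative : ¬ (M.disc p q r ≈ₖ 0#) → ¬ (x′ ≋ []) → g +ℕ g < m →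
      ∃ λ β → ¬ (β ≈ₖ 0#) × (y * y ≋ constP β * x′)
    square∝derivative D≉0 x′≉0 2g<m =
      conclude (form-proportional s-const D-const (degree-nonzero dD) dz dh form≋0) (inverse γ γ≉0)
      where
      D = disc (constP p) (constP q) (constP r)
      s = trace (constP p) (constP q)
      D-const : Constant
      D-const = constant (constP-disc p q r)
      s-const : Constant
      s-const = constant (constP-trace p q)
      dD : Degree 0 D
      dD = degree-resp (≋-sym (constP-disc p q r)) (degree-constP D≉0)
      h = cofactor
      z = D * constP γ * y
      dz : Degree g z
      dz = degree-⊛ (degree-⊛ dD (degree-constP γ≉0)) dy

      h≉0 : ¬ (h ≋ [])
      h≉0 h≋0 = x′≉0 (⊛-zero-cancel (degree-nonzero dD)
        (≋-trans disc-x′ (≋-trans (P.*-congˡ h≋0) (P.zeroʳ y))))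

      n : ℕ
      n = proj₁ (nonzero-degree h≉0)
      dh : Degree n h
      dh = proj₂ (nonzero-degree h≉0)

      -- Degrees in D x′ = y h: the right side has degree g + n, the left at most m - 1.
      g+n<m : g +ℕ n < m
      g+n<m = ℕ.≤-<-trans
        (degree-≤ (degree-⊛ dy dh) (atMost-resp disc-x′ (atMost-⊛ D (bound dD) (atMost-deriv (bound dx)))))
        (ℕ.∸-monoʳ-< (s≤s z≤n) 0<m)

      -- A common bound for the degrees of `z` and `h`.
      e = g ⊔ℕ n

      g+e<m : g +ℕ e < m
      g+e<m = ≡.subst (_< m) (≡.sym (ℕ.+-distribˡ-⊔ g g n)) (ℕ.⊔-pres-<m 2g<m g+n<m)

      -- Tripling `g+e<m` gives 3e + 3g < 3m = d + 2g.
      3e<d : e +ℕ e +ℕ e < d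
      3e<d = ℕ.+-cancelʳ-< (g +ℕ g) _ _ (≡.subst (e +ℕ e +ℕ e +ℕ (g +ℕ g) <_) (≡.sym degree-twist)
        (ℕ.≤-<-trans (ℕ.≤-trans (ℕ.+-monoʳ-≤ (e +ℕ e +ℕ e) (ℕ.m≤m+n (g +ℕ g) g)) (ℕ.≤-reflexive regroup))
          (ℕ.+-mono-< (ℕ.+-mono-< g+e<m g+e<m) g+e<m)))
        where
        regroup : e +ℕ e +ℕ e +ℕ (g +ℕ g +ℕ g) ≡ g +ℕ e +ℕ (g +ℕ e) +ℕ (g +ℕ e)
        regroup = let open +-*-Solver using () renaming (solve to solveℕ; _:+_ to _⊞_; _:=_ to _≐_) in
          solveℕ 2 (λ e g → e ⊞ e ⊞ e ⊞ (g ⊞ g ⊞ g) ≐ g ⊞ e ⊞ (g ⊞ e) ⊞ (g ⊞ e)) ≡.refl e g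

      bz : DegreeAtMost e z
      bz = atMost-mono (ℕ.m≤m⊔n g n) (bound dz)
      bh : DegreeAtMost e h
      bh = atMost-mono (ℕ.m≤n⊔m g n) (bound dh)

      form≋0 : form s D z h ≋ []
      form≋0 = multiple-zero da
        (atMost-⊕ (atMost-⊕ (atMost-⊛ (z * z) (atMost-⊛ z bz bz) bz)
            (atMost-⊖ (atMost-⊛ s (atMost-constant s-const) (atMost-⊛ (z * z) (atMost-⊛ z bz bz) bh))))
          (atMost-⊛ D (bound dD) (atMost-⊛ (h * h) (atMost-⊛ h bh bh) bh)))
        3e<d (proj₂ (a∣form (⊛-cancelˡ y y≉0 disc-tangent)))

      conclude : ∃ (λ b → z ≋ constP b * h) → ∃ (λ γ⁻¹ → γ *ₖ γ⁻¹ ≈ₖ F.1#) →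
        ∃ λ β → ¬ (β ≈ₖ 0#) × (y * y ≋ constP β * x′)
      conclude (b , z≋bh) (γ⁻¹ , γγ⁻¹≈1) = β , β≉0 , y²≋βx′
        where
        -- Obtained from D γ y = b h and D x′ = y h by eliminating `h`.
        β = γ⁻¹ *ₖ b
        y²≋βx′ : y * y ≋ constP β * x′
        y²≋βx′ = ⊛-cancelˡ D (degree-nonzero dD) (≋-trans
          (square-from-proportion D (constP γ) (constP γ⁻¹) (constP b) x′ y h disc-x′ z≋bh
            (≋-trans (≋-sym (constP-* γ γ⁻¹)) (constP-cong γγ⁻¹≈1)))
          (P.*-congˡ (P.*-congʳ (≋-sym (constP-* γ⁻¹ b)))))
        β≉0 : ¬ (β ≈ₖ 0#)
        β≉0 β≈0 = degree-nonzero (degree-⊛ dy dy)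
          (≋-trans y²≋βx′ (≋-trans (P.*-congʳ (≋-trans (constP-cong β≈0) constP-0)) (P.zeroˡ x′)))

    -- The derivative has degree at most m - 1. This serves (C) ⇒ (A) and also bounds the remainder
    -- in `inflection-zero`.
    degree-square : ∀ β → y * y ≋ constP β * x′ → g +ℕ g < m
    degree-square β e = ℕ.≤-<-trans
      (degree-≤ (degree-⊛ dy dy) (atMost-resp (≋-sym e) (atMost-⊛ (constP β) atMost-constP (atMost-deriv (bound dx)))))
      (ℕ.∸-monoʳ-< (s≤s z≤n) 0<m)

    -- The linear pseudo-remainder for c = βγ is shown to vanish at `x`; as `x` is not constant,
    -- both its coefficients are zero, and `inflection-rem` applies.
    inflection-zero : ∀ β → y * y ≋ constP β * x′ → M.inflection p q r ≈ₖ 0#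
    inflection-zero β y²≋βx′ = F.trans (M.inflection-rem p q r k) (F.trans
      (F.+-cong (F.trans (F.*-congˡ (zero-scalar R₀≋0 R₀-const)) (F.zeroʳ _))
        (F.trans (F.-‿cong (F.trans (F.*-congˡ (zero-scalar R₁≋0 R₁-const)) (F.zeroʳ p))) FP.-0#≈0#))
      (F.+-identityˡ 0#))
      where
      k = β *ₖ γ
      R₁ = rem₁ (constP p) (constP q) (constP r) (constP β * constP γ)
      R₀ = rem₀ (constP p) (constP q) (constP r) (constP β * constP γ)

      R₁-const : R₁ ≋ constP (M.rem₁ p q r k)
      R₁-const = constP-rem₁ p q r β γ
      R₀-const : R₀ ≋ constP (M.rem₀ p q r k)
      R₀-const = constP-rem₀ p q r β γ

      zero-scalar : ∀ {u a} → u ≋ [] → u ≋ constP a → a ≈ₖ 0#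
      zero-scalar u≋0 e = coeff-≈ (≋-trans (≋-sym e) u≋0) 0

      bR₁ : DegreeAtMost 0 R₁
      bR₁ = atMost-constant (constant R₁-const)
      bR₀ : DegreeAtMost 0 R₀
      bR₀ = atMost-constant (constant R₀-const)

      2g<m : g +ℕ g < m
      2g<m = degree-square β y²≋βx′

      dy³ : Degree (g +ℕ g +ℕ g) (y * y * y)
      dy³ = degree-⊛ (degree-⊛ dy dy) dy

      -- The left side bounds the degree of (R₁ x + R₀) y³, the right side is the degree of f(x);
      -- both 2g and g are below `m`.
      m+3g<3m : m +ℕ (g +ℕ g +ℕ g) < m +ℕ m +ℕ m
      m+3g<3m = ≡.subst (m +ℕ (g +ℕ g +ℕ g) <_) (≡.sym (ℕ.+-assoc m m m))
        (ℕ.+-monoʳ-< m (ℕ.+-mono-< 2g<m (ℕ.≤-<-trans (ℕ.m≤m+n g g) 2g<m)))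

      line≋0 : R₁ * x + R₀ ≋ []
      line≋0 = ⊛-zero-cancel (degree-nonzero dy³) (≋-trans (P.*-comm _ _)
        (multiple-zero (degree-cubic p q r dx 0<m)
          (atMost-⊛ (R₁ * x + R₀) (atMost-⊕ (atMost-⊛ R₁ bR₁ (bound dx)) (atMost-mono z≤n bR₀)) (bound dy³))
          m+3g<3m
          (proj₂ (cubic∣rem (constP β) y²≋βx′ (⊛-cancelˡ y y≉0 (β-tangent (constP β) y²≋βx′))))))

      R₁≋0 : R₁ ≋ []
      R₁≋0 = constant-zero bR₁ dx bR₀ 0<m line≋0

      R₀≋0 : R₀ ≋ []
      R₀≋0 = ≋-trans (≋-sym (≋-trans (P.+-congʳ (≋-trans (P.*-congʳ R₁≋0) (P.zeroˡ x))) (P.+-identityˡ R₀))) line≋0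

-- Decidable equality in a finite field, and inequalities between degrees.

finite-decidable : ∀ {c ℓ} (K : Field c ℓ) → IsFinite K → Decidable (Field._≈_ K)
finite-decidable K (n , bij) x y with proj₁ (surjective x) Fin.≟ proj₁ (surjective y)
  where open Bijection bij
... | yes i≡j = yes (trans (sym (proj₂ (surjective x) ≡.refl)) (proj₂ (surjective y) i≡j))
  where
  open Field K
  open Bijection bij
-- By injectivity, equal elements have equal chosen preimages in `Fin n`.
... | no i≢j = no λ x≈y → i≢j (injective
    (trans (proj₂ (surjective x) ≡.refl) (trans x≈y (sym (proj₂ (surjective y) ≡.refl)))))
  where
  open Field K
  open Bijection bij

-- Applied to d + 2g = 3m in both directions: 2m < d gives 2g < m, and 2g < m gives 2m < d.
<-complement : ∀ {d t s m} → d +ℕ t ≡ s +ℕ m → s < d → t < m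
<-complement {d} {t} {s} {m} e s<d = ℕ.+-cancelˡ-< s t m (≡.subst (s +ℕ t <_) e (ℕ.+-monoˡ-< t s<d))

-- Positivity matters: for n = 0 truncated subtraction would admit m = 0.
2*≤∸1⇒+< : ∀ m {n} → 0 < n → 2 *ℕ m ≤ n ∸ 1 → m +ℕ m < n
2*≤∸1⇒+< m {suc n} _ 2m≤n = s≤s (≡.subst (λ k → m +ℕ k ≤ n) (ℕ.+-identityʳ m) 2m≤n)

+<⇒2*≤∸1 : ∀ m {n} → m +ℕ m < n → 2 *ℕ m ≤ n ∸ 1
+<⇒2*≤∸1 m {suc n} (s≤s 2m≤n) = ≡.subst (λ k → m +ℕ k ≤ n) (≡.sym (ℕ.+-identityʳ m)) 2m≤n

-- The three conditions and j = 1728 for a general cubic, by passage to the monic one.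

theorem3p4 : ∀ {c ℓ} (K : Field c ℓ) → IsFinite K
    → let open Field K in let open PolyOver K in
      ¬ ((1# + 1#) ≈ 0#)
    → (A : Poly) (d : ℕ) → HasDegree A d → SquareFree A
    → (∃ λ k → d ≡ 2 *ℕ k +ℕ 1) → 1 < d
    → (γ : Carrier) → ¬ (γ ≈ 0#) → deriv A ≈P constP γ
    → (a0 a1 a2 a3 : Carrier) → Cubic.IsElliptic a0 a1 a2 a3
    → (F G : Poly) → (A *P (G *P G)) ≈P cubicAt a0 a1 a2 a3 F
    → ¬ (deriv F ≈P [])
    → let condA = ∀ m → ¬ (coeff F m ≈ 0#) → 2 *ℕ m ≤ d ∸ 1
          condB = ∀ dF → HasDegree F dF → ∀ m → ¬ (coeff G m ≈ 0#) → 2 *ℕ m ≤ dF ∸ 1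
          condC = ∃ λ β → ¬ (β ≈ 0#) × ((G *P G) ≈P (constP β *P deriv F))
      in ((condA → condB) × (condB → condC) × (condC → condA))
         × (condA ⊎ condB ⊎ condC → Cubic.j≈1728 a0 a1 a2 a3)
theorem3p4 K finite _ A d A-degree _ _ 1<d γ γ≉0 A′ a0 a1 a2 a3 (a3≉0 , Δ≉0) F G onCurve F′≉0 =
  (A⇒B , B⇒C , C⇒A) , [ (λ a → C⇒j (B⇒C (A⇒B a))) , [ (λ b → C⇒j (B⇒C b)) , C⇒j ]′ ]′
  where
  _≟_ = finite-decidable K finite
  open Field K
  open PolyOver K
  open PolynomialRing K
  open Degrees K _≟_
  open Twist K _≟_
  module P = CommutativeRing polynomialRing
  module M = MonicCubic commutativeRing
  module MP = MonicCubic polynomialRing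
  open IntegerSolver polynomialRing
  open SetoidReasoning ≋-setoid
  open Cubic a0 a1 a2 a3

  -- Degrees are bounded through the indices of nonzero coefficients: such a bound is used at the
  -- leading index and proved at every index up to it.
  condA = ∀ m → ¬ (coeff F m ≈ 0#) → 2 *ℕ m ≤ d ∸ 1
  condB = ∀ dF → HasDegree F dF → ∀ m → ¬ (coeff G m ≈ 0#) → 2 *ℕ m ≤ dF ∸ 1
  condC = ∃ λ β → ¬ (β ≈ 0#) × ((G *P G) ≈P (constP β *P deriv F))

  α = constP a3
  x = α ⊛ F
  y = α ⊛ G

  -- The statement uses `*P` and `+P`, which `⊛` and `⊕` become once unfolded; the three conversions
  -- here pass between them.
  opaque
    unfolding _⊛_

    G²∝F′⇒ : ∀ {β} → (G *P G) ≈P (constP β *P deriv F) → G ⊛ G ≋ constP β ⊛ deriv F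
    G²∝F′⇒ = coeffs

    ⇒G²∝F′ : ∀ {β} → G ⊛ G ≋ constP β ⊛ deriv F → (G *P G) ≈P (constP β *P deriv F)
    ⇒G²∝F′ = coeff-≈

    onTwist : A ⊛ (G ⊛ G) ≋ constP a0 ⊕ (constP a1 ⊛ F ⊕ (constP a2 ⊛ (F ⊛ F) ⊕ α ⊛ (F ⊛ F ⊛ F)))
    onTwist = coeffs onCurve

  onMonicTwist : A ⊛ (y ⊛ y) ≋ MP.cubic (constP W2) (constP W4) (constP W6) x
  onMonicTwist = ≋-trans (MP.rescale A (constP a0) (constP a1) (constP a2) α F G onTwist)
    -- Products of constants are gathered into `W4` = a₃ a₁ and `W6` = a₃² a₀.
    (P.+-cong (P.*-congʳ (P.+-congˡ (≋-sym (constP-* a3 a1))))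
      (≋-sym (≋-trans (constP-* (a3 * a3) a0) (P.*-congʳ (constP-* a3 a3)))))

  dA : Degree d A
  dA = degree (proj₁ A-degree) (atMost (proj₂ A-degree))

  dα : Degree 0 α
  dα = degree-constP a3≉0

  F≉0 : ¬ (F ≋ [])
  F≉0 F≋0 = F′≉0 (coeff-≈ (deriv-cong F≋0))

  m = proj₁ (nonzero-degree F≉0)
  dF : Degree m F
  dF = proj₂ (nonzero-degree F≉0)

  -- A constant `F` would have derivative zero.
  0<m : 0 < m
  0<m = ℕ.≮⇒≥ λ m<1 → F′≉0 (coeff-≈ (deriv-constant (atMost-mono (ℕ.≤-pred m<1) (bound dF))))

  dx : Degree m x
  dx = degree-⊛ dα dF

  -- With G = 0 the cubic in `x` would vanish, although it has degree 3m.
  G≉0 : ¬ (G ≋ [])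
  G≉0 G≋0 = degree-nonzero (degree-cubic W2 W4 W6 dx 0<m) (≋-trans (≋-sym onMonicTwist)
    (≋-trans (P.*-congˡ (≋-trans (P.*-congˡ (≋-trans (P.*-congˡ G≋0) (P.zeroʳ α))) (P.zeroʳ y))) (P.zeroʳ A)))

  g = proj₁ (nonzero-degree G≉0)
  dG : Degree g G
  dG = proj₂ (nonzero-degree G≉0)

  dy : Degree g y
  dy = degree-⊛ dα dG

  relation : d +ℕ (g +ℕ g) ≡ m +ℕ m +ℕ m
  relation = degree-twist W2 W4 W6 γ γ≉0 dA dx dy 0<m (coeffs A′) onMonicTwist

  x′≋αF′ : deriv x ≋ α ⊛ deriv F
  x′≋αF′ = ≋-trans (deriv-⊛ α F) (≋-trans (P.+-congʳ (P.zeroˡ F)) (P.+-identityˡ _))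

  x′≉0 : ¬ (deriv x ≋ [])
  x′≉0 x′≋0 = F′≉0 (coeff-≈ (⊛-zero-cancel (degree-nonzero dα) (≋-trans (≋-sym x′≋αF′) x′≋0)))

  disc≉0 : ¬ (M.disc W2 W4 W6 ≈ 0#)
  disc≉0 D≈0 = Δ≉0 (trans (M.Δ-disc W2 W4 W6) (trans (*-congˡ D≈0) (zeroʳ _)))

  -- The square of `y` carries a₃² and the derivative of `x` only a₃, so the remaining a₃ joins β;
  -- `unscale-square` divides by it.
  rescale-square : ∀ {β} → G ⊛ G ≋ constP β ⊛ deriv F → y ⊛ y ≋ constP (a3 * β) ⊛ deriv x
  rescale-square {β} G² = begin
    y ⊛ y                              ≈⟨ solve 2 (λ α G → α :* G :* (α :* G) := α :* α :* (G :* G)) ≋-refl α G ⟩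
    α ⊛ α ⊛ (G ⊛ G)                    ≈⟨ P.*-congˡ G² ⟩
    α ⊛ α ⊛ (constP β ⊛ deriv F)
      ≈⟨ solve 3 (λ α β F′ → α :* α :* (β :* F′) := α :* β :* (α :* F′)) ≋-refl α (constP β) (deriv F) ⟩
    α ⊛ constP β ⊛ (α ⊛ deriv F)       ≈⟨ P.*-cong (constP-* a3 β) x′≋αF′ ⟨
    constP (a3 * β) ⊛ deriv x          ∎

  unscale-square : ∀ {β a3⁻¹} → a3 * a3⁻¹ ≈ 1# → y ⊛ y ≋ constP β ⊛ deriv x → G ⊛ G ≋ constP (β * a3⁻¹) ⊛ deriv F
  unscale-square {β} {a3⁻¹} e y² = ⊛-cancelˡ α (degree-nonzero dα) (⊛-cancelˡ α (degree-nonzero dα) (begin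
    α ⊛ (α ⊛ (G ⊛ G))                  ≈⟨ solve 2 (λ α G → α :* (α :* (G :* G)) := α :* G :* (α :* G)) ≋-refl α G ⟩
    y ⊛ y                              ≈⟨ y² ⟩
    constP β ⊛ deriv x                 ≈⟨ P.*-congˡ x′≋αF′ ⟩
    -- Inserting 1 = a₃ a₃⁻¹ supplies the second factor `α` for the two cancellations.
    constP β ⊛ (α ⊛ deriv F)           ≈⟨ P.*-identityˡ _ ⟨
    constP 1# ⊛ (constP β ⊛ (α ⊛ deriv F))
      ≈⟨ P.*-congʳ (≋-trans (≋-sym (constP-* a3 a3⁻¹)) (constP-cong e)) ⟨
    α ⊛ constP a3⁻¹ ⊛ (constP β ⊛ (α ⊛ deriv F))
      ≈⟨ solve 4 (λ α i β F′ → α :* i :* (β :* (α :* F′)) := α :* (α :* (β :* i :* F′)))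
           ≋-refl α (constP a3⁻¹) (constP β) (deriv F) ⟩
    α ⊛ (α ⊛ (constP β ⊛ constP a3⁻¹ ⊛ deriv F))
      ≈⟨ P.*-congˡ (P.*-congˡ (P.*-congʳ (constP-* β a3⁻¹))) ⟨
    α ⊛ (α ⊛ (constP (β * a3⁻¹) ⊛ deriv F)) ∎))

  nonzero-≤ : ∀ {k n p} → Degree n p → ¬ (coeff p k ≈ 0#) → k ≤ n
  nonzero-≤ {k} {n} dp k≉0 = ℕ.≮⇒≥ λ n<k → k≉0 (vanish (bound dp) k n<k)

  2g<m⇒B : g +ℕ g < m → condB
  2g<m⇒B 2g<m n (F-leading , F-bound) k k≉0 =
    +<⇒2*≤∸1 k (≡.subst (k +ℕ k <_) m≡n (ℕ.≤-<-trans (ℕ.+-mono-≤ k≤g k≤g) 2g<m))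
    where
    k≤g = nonzero-≤ dG k≉0
    m≡n : m ≡ n
    m≡n = degree-unique dF (degree F-leading (atMost F-bound))

  A⇒B : condA → condB
  -- (A) at the leading index of `F` reads 2m < d, and the degree relation turns this into 2g < m.
  A⇒B a = 2g<m⇒B (<-complement relation (2*≤∸1⇒+< m (ℕ.<-trans (s≤s z≤n) 1<d) (a m (leading dF))))

  B⇒C : condB → condC
  B⇒C b = unscale
    (square∝derivative W2 W4 W6 γ γ≉0 dA dx dy 0<m (coeffs A′) onMonicTwist disc≉0 x′≉0
      (2*≤∸1⇒+< g 0<m (b m (leading dF , vanish (bound dF)) g (leading dG))))
    (inverse a3 a3≉0)
    where
    unscale : (∃ λ β → ¬ (β ≈ 0#) × (y ⊛ y ≋ constP β ⊛ deriv x)) → (∃ λ a3⁻¹ → a3 * a3⁻¹ ≈ 1#) → condC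
    unscale (β , β≉0 , y²) (a3⁻¹ , e) = β * a3⁻¹ , βa3⁻¹≉0 , ⇒G²∝F′ (unscale-square e y²)
      where
      βa3⁻¹≉0 : ¬ (β * a3⁻¹ ≈ 0#)
      βa3⁻¹≉0 z = 1≉0 (trans (sym e) (trans (*-congˡ (zero-product β≉0 z)) (zeroʳ a3)))

  C⇒A : condC → condA
  -- The degree relation is reversed, so that `<-complement` turns 2g < m into 2m < d.
  C⇒A (β , _ , G²) k k≉0 = +<⇒2*≤∸1 k (ℕ.≤-<-trans (ℕ.+-mono-≤ k≤m k≤m) (<-complement
    (≡.trans (ℕ.+-comm m (m +ℕ m)) (≡.trans (≡.sym relation) (ℕ.+-comm d (g +ℕ g))))
    (degree-square W2 W4 W6 γ γ≉0 dA dx dy 0<m (coeffs A′) onMonicTwist (a3 * β) (rescale-square (G²∝F′⇒ G²)))))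
    where k≤m = nonzero-≤ dF k≉0

  C⇒j : condC → j≈1728
  C⇒j (β , _ , G²) = trans (M.c₄³-Δ W2 W4 W6)
    (trans (+-congˡ (trans (*-congˡ (trans (*-congˡ inflection≈0) (zeroʳ _))) (zeroʳ _))) (+-identityʳ _))
    where
    inflection≈0 : M.inflection W2 W4 W6 ≈ 0#
    inflection≈0 = inflection-zero W2 W4 W6 γ γ≉0 dA dx dy 0<m (coeffs A′) onMonicTwist
      (a3 * β) (rescale-square (G²∝F′⇒ G²))
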